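{- Unless the Exponential Time Hypothesis fails, the $k$-median problem cannot be solved in time $2^{o(n)}$, where $n$ is the number of points in the input metric space $X$.
   Context: $k$-median: the input is a finite metric space $(X,d)$ with $X=\{x_1,\dots,x_n\}$ and a positive integer $k$. A solution is a pair $(C,P)$ where $C=\{c_1,\dots,c_k\}\subseteq X$ is a set of $k$ centers and $P$ is a partition of $X$ into $k$ subsets (clusters) $X_1,\dots,X_k$, with $X_i$ being the cluster corresponding to the center $c_i$. The task is to find a pair $(C,P)$ minimizing $\mathrm{cost}(C,P)=\sum_{i=1}^{k}\sum_{x\in X_i} d(c_i,x)$. A $q$-CNF formula is a conjunction of clauses, each of which is a disjunction of at most $q$ literals; $q$-SAT asks whether a given $q$-CNF formula is satisfiable. Exponential Time Hypothesis (ETH): $q$-SAT, $q\ge 3$, cannot be solved within a running time of $2^{o(N)}$ or $2^{o(M)}$, where $N$ is the number of variables and $M$ is the number of clauses of the input $q$-CNF formula. -}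

module Defs where

open import Data.Bool.Base using (Bool; true; false; not)
open import Data.Fin.Base as Fin using (Fin; toℕ)
open import Data.Fin.Properties using (_≟_)
open import Data.Integer.Base as ℤ using (ℤ; +_; -[1+_])
open import Data.List.Base
  using (List; []; _∷_; map; foldr; filter; length; allFin; tabulate)
open import Data.List.Relation.Unary.All using (All)
open import Data.List.Relation.Unary.Any using (Any)
open import Data.Nat.Base using (ℕ; zero; suc; _+_; _*_; _^_; _≤_; _≥_)
open import Data.Nat.Binary.Base as Bin using (ℕᵇ; 2[1+_]; 1+[2_])
open import Data.Product.Base using (Σ; ∃; _×_; _,_)
open import Data.Rational.Base as ℚ using (ℚ; 0ℚ)
open import Data.Vec.Base as Vec using (Vec; lookup; _[_]≔_)
open import Function.Definitions using (Injective; StrictlySurjective)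
open import Function.Metric.Rational.Structures using (IsMetric)
open import Relation.Binary.PropositionalEquality.Core using (_≡_; _≢_)
open import Relation.Nullary using (¬_; Dec; does)

------------------------------------------------------------------------
-- Model of computation: the WHILE language over binary trees, with the
-- cost model of N. D. Jones, "Computability and Complexity from a
-- Programming Perspective" (one time unit per elementary operation; hd,
-- tl and cons are pointer operations on shared trees).  Running times
-- agree with those of Turing machines up to a polynomial.

infixr 5 _∙_

data Tree : Set where
  nil : Tree
  _∙_ : Tree → Tree → Tree

size : Tree → ℕ
size nil     = 1
size (s ∙ t) = 1 + size s + size t

head : Tree → Tree
head nil     = nil
head (s ∙ _) = s

tail : Tree → Tree
tail nil     = nil
tail (_ ∙ t) = t

data Expr (v : ℕ) : Set where
  var   : Fin v → Expr v
  const : Tree → Expr v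
  cons  : Expr v → Expr v → Expr v
  hd tl : Expr v → Expr v

infix  6 _:=_
infixr 5 _⨾_

data Cmd (v : ℕ) : Set where
  _:=_          : Fin v → Expr v → Cmd v
  _⨾_           : Cmd v → Cmd v → Cmd v
  if_then_else_ : Expr v → Cmd v → Cmd v → Cmd v
  while_repeat_ : Expr v → Cmd v → Cmd v

Store : ℕ → Set
Store v = Vec Tree v

eval : ∀ {v} → Expr v → Store v → Tree
eval (var x)    σ = lookup σ x
eval (const t)  σ = t
eval (cons e f) σ = eval e σ ∙ eval f σ
eval (hd e)     σ = head (eval e σ)
eval (tl e)     σ = tail (eval e σ)

cost : ∀ {v} → Expr v → ℕ
cost (var x)    = 1
cost (const t)  = 1
cost (cons e f) = 1 + cost e + cost f
cost (hd e)     = 1 + cost e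
cost (tl e)     = 1 + cost e

-- ⟨ C , σ ⟩⇓ σ′ ⟨ t ⟩ : started in store σ, the command C halts in store
-- σ′ after exactly t time units.  In tests, nil means false and every
-- other tree means true.
infix 4 ⟨_,_⟩⇓_⟨_⟩

data ⟨_,_⟩⇓_⟨_⟩ {v : ℕ} : Cmd v → Store v → Store v → ℕ → Set where
  assign  : ∀ {x e σ} →
            ⟨ x := e , σ ⟩⇓ σ [ x ]≔ eval e σ ⟨ 1 + cost e ⟩
  seq     : ∀ {C D σ σ′ σ″ s t} →
            ⟨ C , σ ⟩⇓ σ′ ⟨ s ⟩ → ⟨ D , σ′ ⟩⇓ σ″ ⟨ t ⟩ →
            ⟨ C ⨾ D , σ ⟩⇓ σ″ ⟨ s + t ⟩
  if-yes  : ∀ {e C D σ σ′ t} → eval e σ ≢ nil →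
            ⟨ C , σ ⟩⇓ σ′ ⟨ t ⟩ →
            ⟨ if e then C else D , σ ⟩⇓ σ′ ⟨ 1 + cost e + t ⟩
  if-no   : ∀ {e C D σ σ′ t} → eval e σ ≡ nil →
            ⟨ D , σ ⟩⇓ σ′ ⟨ t ⟩ →
            ⟨ if e then C else D , σ ⟩⇓ σ′ ⟨ 1 + cost e + t ⟩
  loop    : ∀ {e C σ σ′ σ″ s t} → eval e σ ≢ nil →
            ⟨ C , σ ⟩⇓ σ′ ⟨ s ⟩ → ⟨ while e repeat C , σ′ ⟩⇓ σ″ ⟨ t ⟩ →
            ⟨ while e repeat C , σ ⟩⇓ σ″ ⟨ 1 + cost e + s + t ⟩
  exit    : ∀ {e C σ} → eval e σ ≡ nil →
            ⟨ while e repeat C , σ ⟩⇓ σ ⟨ 1 + cost e ⟩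

-- Variable zero holds the input at the start and the output at the end;
-- all other variables are initially nil.
record Program : Set where
  constructor program
  field
    {vars} : ℕ
    body   : Cmd (suc vars)

Runs : Program → Tree → Tree → ℕ → Set
Runs (program {v} C) input output t =
  Σ (Store v) λ σ →
    ⟨ C , input Vec.∷ Vec.replicate v nil ⟩⇓ output Vec.∷ σ ⟨ t ⟩

------------------------------------------------------------------------
-- Computational problems and running time 2^o(m)

record Problem : Set₁ where
  field
    Instance : Set
    encode   : Instance → Tree
    Correct  : Instance → Tree → Set

LittleO : (ℕ → ℕ) → Set
LittleO f = ∀ c → ∃ λ n₀ → ∀ n → n ≥ n₀ → c * f n ≤ n

-- As usual for exponential-time bounds, 2^o(m) is up to a factor
-- polynomial in the length of the input.  Without it the notion would
-- degenerate, because m does not bound the length: distances are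
-- arbitrarily long numbers, and a formula may repeat clauses or have many
-- unused variables.
SolvableInTime2^o : (Π : Problem) → (Problem.Instance Π → ℕ) → Set
SolvableInTime2^o Π m =
  Σ Program λ p → Σ (ℕ → ℕ) λ f → LittleO f × ∃ λ a → ∃ λ b →
    ∀ (I : Instance) → ∃ λ output → ∃ λ t →
      Runs p (encode I) output t ×
      Correct I output ×
      t ≤ 2 ^ f (m I) * (a * size (encode I) ^ b)
  where open Problem Π

------------------------------------------------------------------------
-- Encodings; numbers are written in binary

encodeBool : Bool → Tree
encodeBool false = nil
encodeBool true  = nil ∙ nil

encodeList : ∀ {A : Set} → (A → Tree) → List A → Tree
encodeList enc []       = nil
encodeList enc (x ∷ xs) = enc x ∙ encodeList enc xs

encodeℕᵇ : ℕᵇ → Tree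
encodeℕᵇ Bin.zero = nil
encodeℕᵇ 2[1+ n ] = encodeBool false ∙ encodeℕᵇ n
encodeℕᵇ 1+[2 n ] = encodeBool true ∙ encodeℕᵇ n

encodeℕ : ℕ → Tree
encodeℕ n = encodeℕᵇ (Bin.fromℕ n)

encodeFin : ∀ {n} → Fin n → Tree
encodeFin i = encodeℕ (toℕ i)

encodeℤ : ℤ → Tree
encodeℤ (+ n)    = encodeBool true ∙ encodeℕ n
encodeℤ -[1+ n ] = encodeBool false ∙ encodeℕ n

encodeℚ : ℚ → Tree
encodeℚ r = encodeℤ (ℚ.numerator r) ∙ encodeℕ (ℚ.denominatorℕ r)

------------------------------------------------------------------------
-- q-SAT

data Literal (N : ℕ) : Set where
  pos neg : Fin N → Literal N

record CNF (q : ℕ) : Set where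
  field
    #vars   : ℕ
    clauses : List (List (Literal #vars))
    width   : All (λ c → length c ≤ q) clauses

  #clauses : ℕ
  #clauses = length clauses

open CNF public using (#vars; #clauses)

value : ∀ {N} → (Fin N → Bool) → Literal N → Bool
value α (pos x) = α x
value α (neg x) = not (α x)

Satisfiable : ∀ {q} → CNF q → Set
Satisfiable φ =
  ∃ λ (α : Fin (#vars φ) → Bool) →
    All (Any (λ l → value α l ≡ true)) (CNF.clauses φ)

encodeLiteral : ∀ {N} → Literal N → Tree
encodeLiteral (pos x) = encodeBool true ∙ encodeFin x
encodeLiteral (neg x) = encodeBool false ∙ encodeFin x

SAT : ℕ → Problem
SAT q = record
  { Instance = CNF q
  ; encode   = λ φ → encodeℕ (#vars φ) ∙
                     encodeList (encodeList encodeLiteral) (CNF.clauses φ)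
  ; Correct  = λ φ output →
                 Σ (Dec (Satisfiable φ)) λ d → output ≡ encodeBool (does d)
  }

ETH : Set
ETH = ∀ q → q ≥ 3 →
  ¬ SolvableInTime2^o (SAT q) #vars × ¬ SolvableInTime2^o (SAT q) #clauses

------------------------------------------------------------------------
-- k-median

-- Distances are rational so that instances are finite objects.  Without
-- k ≤ n there would be no set of k centers.
record KMedianInstance : Set where
  field
    n k      : ℕ
    1≤k      : 1 ≤ k
    k≤n      : k ≤ n
    d        : Fin n → Fin n → ℚ
    isMetric : IsMetric _≡_ d

open KMedianInstance public using () renaming (n to #points)

sumℚ : List ℚ → ℚ
sumℚ = foldr ℚ._+_ 0ℚ

module _ (I : KMedianInstance) where
  open KMedianInstance I

  -- The partition is given by sending each point to the index of its
  -- cluster; surjectivity says that every cluster is nonempty.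
  record Solution : Set where
    field
      center             : Fin k → Fin n
      center-injective   : Injective _≡_ _≡_ center
      cluster            : Fin n → Fin k
      cluster-surjective : StrictlySurjective _≡_ cluster

  open Solution

  members : Solution → Fin k → List (Fin n)
  members S i = filter (λ x → cluster S x ≟ i) (allFin n)

  clusteringCost : Solution → ℚ
  clusteringCost S =
    sumℚ (map (λ i → sumℚ (map (d (center S i)) (members S i))) (allFin k))

  Optimal : Solution → Set
  Optimal S = ∀ S′ → clusteringCost S ℚ.≤ clusteringCost S′

  encodeSolution : Solution → Tree
  encodeSolution S =
    encodeList encodeFin (tabulate (center S)) ∙
    encodeList encodeFin (tabulate (cluster S))

  encodeKMedianInstance : Tree
  encodeKMedianInstance =
    encodeℕ k ∙
    encodeList (encodeList encodeℚ) (tabulate λ x → tabulate (d x))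

KMedian : Problem
KMedian = record
  { Instance = KMedianInstance
  ; encode   = encodeKMedianInstance
  ; Correct  = λ I output →
                 Σ (Solution I) λ S → output ≡ encodeSolution I S × Optimal I S
  }

{-# OPTIONS --safe #-}

-- From a 3-CNF formula with M clauses build a metric space of O(M) points with
-- distances 0, 1 and 2.  The points are the literals x and ¬x of the occurring
-- variables, the clauses, and a tautology x ∨ ¬x for every variable.  Two
-- literals are at distance 1, and so are a literal and a clause containing it;
-- all other distances are 2.  With k the number of variables, a solution costs
-- at least n − k, with equality iff every point is a center or at distance 1
-- from its center.  The closed neighbourhoods of the k tautologies are
-- disjoint, so equality forces one center in each of them and none elsewhere,
-- and the chosen literals satisfy all clauses; conversely a satisfying
-- assignment gives such a solution.  Hence the formula is satisfiable iff it
-- is satisfied by the literals chosen in an optimal solution.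
--
-- Both the construction of the space and this final test are composed from a
-- small algebra of polynomial-time functions, closed under folds whose step
-- adds at most polynomially much to the accumulator.
module Submission where

open import Defs
open import Relation.Nullary using (¬_; Dec; does; yes; no)

open import Data.Bool.Base as Bool using (Bool; true; false; _∧_; _∨_; _xor_; not)
import Data.Bool.Properties as Bool
open import Data.Fin.Base as Fin using (Fin; zero; suc; punchIn; punchOut; toℕ)
import Data.Fin.Properties as Fin
import Data.Integer.Base as ℤ
import Data.Integer.Properties as ℤ
open import Data.List.Base as List
  using (List; []; _∷_; [_]; _++_; allFin; concatMap; deduplicate; filter; foldl; foldr; length; lookup; map; reverse; tabulate)
open import Data.List.Membership.Propositional using (_∈_; find; lose)
open import Data.List.Membership.Propositional.Properties
import Data.List.Properties as List
open import Data.List.Relation.Unary.All as All using (All; []; _∷_)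
import Data.List.Relation.Unary.All.Properties as All
open import Data.List.Relation.Unary.AllPairs using ([]; _∷_)
open import Data.List.Relation.Unary.Any as Any using (Any; here; there; index)
import Data.List.Relation.Unary.Any.Properties as Any
open import Data.List.Relation.Unary.Unique.DecPropositional.Properties using (deduplicate-!)
open import Data.List.Relation.Unary.Unique.Propositional using (Unique)
import Data.List.Relation.Unary.Unique.Propositional.Properties as Unique
open import Data.Nat.Base
open import Data.Nat.Binary.Base as Bin using (ℕᵇ; 2[1+_]; 1+[2_])
import Data.Nat.Binary.Properties as Bin
open import Data.Nat.ListAction using (sum)
open import Data.Nat.Properties as ℕ hiding (_≟_)
open import Data.Nat.Tactic.RingSolver using (solve-∀)
open import Data.Product.Base using (∃; _×_; _,_; proj₁; proj₂; uncurry)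
open import Data.Product.Properties using (,-injective)
open import Data.Rational.Base as ℚ using (ℚ)
import Data.Rational.Properties as ℚ
import Data.Rational.Unnormalised.Base as ℚᵘ
import Data.Rational.Unnormalised.Properties as ℚᵘ
open import Data.Sum.Base as Sum using (_⊎_; inj₁; inj₂)
open import Data.Vec.Base as Vec using (Vec; []; _∷_; _[_]≔_; insertAt)
open import Data.Vec.Properties using (insertAt-punchIn)
open import Function.Base using (_∘_; id)
open import Function.Definitions using (Injective)
open import Function.Metric.Rational.Structures using (IsMetric)
open import Relation.Binary.Definitions using (DecidableEquality)
open import Relation.Binary.PropositionalEquality as ≡
  using (_≡_; _≢_; refl; sym; trans; cong; cong₂; subst; subst₂)
open import Relation.Nullary.Decidable using (map′; _×-dec_; _⊎-dec_; ¬?)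
open import Relation.Nullary.Negation using (contradiction)

-- The hypothesis is used in its form for the number M of clauses: at width 3 the space has n ≤ 3 +
-- 10 M points, so 2^o(n) turns into 2^o(M). The tautologies are the device that makes the centers
-- consistent. Without them nothing would prevent both x and ¬x from being centers; a tautology
-- demands a center among three points that no other tautology can use. The assignment read off a
-- solution is tested, not trusted. A passed test already exhibits a satisfying assignment, so the
-- geometry serves only the converse. Two obstacles shape the programs. First, `cons` costs one unit
-- however large its arguments are, so a time bound does not bound the size of a result;
-- polynomial-time functions therefore carry a separate size bound. Second, the solver is an
-- arbitrary program, possibly exponential and free to overwrite all its variables: the formula
-- waits in a variable that the solver does not have, and the size of the output is bounded through
-- its correctness instead of the running time.

infixl 6 _⊕_
infixl 7 _⊛_
infixr 8 _⊚_

-- Polynomial bounds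

data Polynomial : Set where
  X           : Polynomial
  K           : ℕ → Polynomial
  _⊕_ _⊛_ _⊚_ : Polynomial → Polynomial → Polynomial

⟦_⟧ : Polynomial → ℕ → ℕ
⟦ X ⟧     n = n
⟦ K c ⟧   n = c
⟦ p ⊕ q ⟧ n = ⟦ p ⟧ n + ⟦ q ⟧ n
⟦ p ⊛ q ⟧ n = ⟦ p ⟧ n * ⟦ q ⟧ n
⟦ p ⊚ q ⟧ n = ⟦ p ⟧ (⟦ q ⟧ n)

⟦⟧-mono : ∀ p {m n} → m ≤ n → ⟦ p ⟧ m ≤ ⟦ p ⟧ n
⟦⟧-mono X       m≤n = m≤n
⟦⟧-mono (K c)   m≤n = ≤-refl
⟦⟧-mono (p ⊕ q) m≤n = +-mono-≤ (⟦⟧-mono p m≤n) (⟦⟧-mono q m≤n)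
⟦⟧-mono (p ⊛ q) m≤n = *-mono-≤ (⟦⟧-mono p m≤n) (⟦⟧-mono q m≤n)
⟦⟧-mono (p ⊚ q) m≤n = ⟦⟧-mono p (⟦⟧-mono q m≤n)

power : ℕ → Polynomial
power zero    = K 1
power (suc b) = X ⊛ power b

⟦power⟧ : ∀ b n → ⟦ power b ⟧ n ≡ n ^ b
⟦power⟧ zero    n = refl
⟦power⟧ (suc b) n = cong (n *_) (⟦power⟧ b n)

^-distribʳ-* : ∀ m n b → (m * n) ^ b ≡ m ^ b * n ^ b
^-distribʳ-* m n zero    = refl
^-distribʳ-* m n (suc b) rewrite ^-distribʳ-* m n b = rearrange m n (m ^ b) (n ^ b)
  where
  rearrange : ∀ m n x y → m * n * (x * y) ≡ m * x * (n * y)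
  rearrange = solve-∀

-- At 0 a monomial of positive degree vanishes while a constant term does not, hence the positive
-- argument. Sizes of trees are positive.
⟦⟧-monomial : ∀ p → ∃ λ a → ∃ λ b → ∀ n → .{{NonZero n}} → ⟦ p ⟧ n ≤ a * n ^ b
⟦⟧-monomial X     = 1 , 1 , λ n → ≤-reflexive (lemma n)
  where
  lemma : ∀ n → n ≡ 1 * (n * 1)
  lemma = solve-∀
⟦⟧-monomial (K c) = c , 0 , λ n → ≤-reflexive (sym (*-identityʳ c))
⟦⟧-monomial (p ⊕ q) with ⟦⟧-monomial p | ⟦⟧-monomial q
... | a , b , p≤ | c , d , q≤ = a + c , b + d , λ n → begin
  ⟦ p ⟧ n + ⟦ q ⟧ n                     ≤⟨ +-mono-≤ (p≤ n) (q≤ n) ⟩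
  a * n ^ b + c * n ^ d                 ≤⟨ +-mono-≤ (*-monoʳ-≤ a (^-monoʳ-≤ n (m≤m+n b d))) (*-monoʳ-≤ c (^-monoʳ-≤ n (m≤n+m d b))) ⟩
  a * n ^ (b + d) + c * n ^ (b + d)     ≡⟨ *-distribʳ-+ (n ^ (b + d)) a c ⟨
  (a + c) * n ^ (b + d)                 ∎
  where open ≤-Reasoning
⟦⟧-monomial (p ⊛ q) with ⟦⟧-monomial p | ⟦⟧-monomial q
... | a , b , p≤ | c , d , q≤ = a * c , b + d , λ n → begin
  ⟦ p ⟧ n * ⟦ q ⟧ n               ≤⟨ *-mono-≤ (p≤ n) (q≤ n) ⟩
  a * n ^ b * (c * n ^ d)         ≡⟨ rearrange a c (n ^ b) (n ^ d) ⟩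
  a * c * (n ^ b * n ^ d)         ≡⟨ cong (a * c *_) (^-distribˡ-+-* n b d) ⟨
  a * c * n ^ (b + d)             ∎
  where
  open ≤-Reasoning
  rearrange : ∀ a c x y → a * x * (c * y) ≡ a * c * (x * y)
  rearrange = solve-∀
⟦⟧-monomial (p ⊚ q) with ⟦⟧-monomial p | ⟦⟧-monomial q
-- `suc c` in place of `c` keeps the inner value positive, as the bound for `p` requires.
... | a , b , p≤ | c , d , q≤ = a * suc c ^ b , d * b , λ n → begin
  ⟦ p ⟧ (⟦ q ⟧ n)                 ≤⟨ ⟦⟧-mono p (q≤′ n) ⟩
  ⟦ p ⟧ (suc c * n ^ d)           ≤⟨ p≤ (suc c * n ^ d) {{m*n≢0 (suc c) (n ^ d) {{_}} {{m^n≢0 n d}}}} ⟩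
  a * (suc c * n ^ d) ^ b         ≡⟨ cong (a *_) (^-distribʳ-* (suc c) (n ^ d) b) ⟩
  a * (suc c ^ b * (n ^ d) ^ b)   ≡⟨ *-assoc a _ _ ⟨
  a * suc c ^ b * (n ^ d) ^ b     ≡⟨ cong (a * suc c ^ b *_) (^-*-assoc n d b) ⟩
  a * suc c ^ b * n ^ (d * b)     ∎
  where
  open ≤-Reasoning
  q≤′ : ∀ n → .{{NonZero n}} → ⟦ q ⟧ n ≤ suc c * n ^ d
  q≤′ n = ≤-trans (q≤ n) (*-monoˡ-≤ (n ^ d) (n≤1+n c))

size>0 : ∀ t → NonZero (size t)
size>0 nil     = _
size>0 (_ ∙ _) = _

-- Executions within a time bound

infix 4 ⟨_,_⟩⇒_within_
infixr 5 _▷_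

record ⟨_,_⟩⇒_within_ {v} (C : Cmd v) (σ σ′ : Store v) (b : ℕ) : Set where
  constructor run
  field
    {steps} : ℕ
    exec    : ⟨ C , σ ⟩⇓ σ′ ⟨ steps ⟩
    steps≤  : steps ≤ b

open ⟨_,_⟩⇒_within_

assign′ : ∀ {v x e} {σ : Store v} → ⟨ x := e , σ ⟩⇒ σ [ x ]≔ eval e σ within (1 + cost e)
assign′ = run assign ≤-refl

_▷_ : ∀ {v C D} {σ σ′ σ″ : Store v} {b c} →
      ⟨ C , σ ⟩⇒ σ′ within b → ⟨ D , σ′ ⟩⇒ σ″ within c → ⟨ C ⨾ D , σ ⟩⇒ σ″ within (b + c)
run p p≤ ▷ run q q≤ = run (seq p q) (+-mono-≤ p≤ q≤)

relax : ∀ {v C} {σ σ′ : Store v} {b c} → b ≤ c → ⟨ C , σ ⟩⇒ σ′ within b → ⟨ C , σ ⟩⇒ σ′ within c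
relax b≤c (run p p≤) = run p (≤-trans p≤ b≤c)

if-true : ∀ {v e} {C D : Cmd v} {σ σ′ b} → eval e σ ≢ nil →
          ⟨ C , σ ⟩⇒ σ′ within b → ⟨ if e then C else D , σ ⟩⇒ σ′ within (1 + cost e + b)
if-true {e = e} e≢ (run p p≤) = run (if-yes e≢ p) (+-monoʳ-≤ (1 + cost e) p≤)

if-false : ∀ {v e} {C D : Cmd v} {σ σ′ b} → eval e σ ≡ nil →
           ⟨ D , σ ⟩⇒ σ′ within b → ⟨ if e then C else D , σ ⟩⇒ σ′ within (1 + cost e + b)
if-false {e = e} e≡ (run p p≤) = run (if-no e≡ p) (+-monoʳ-≤ (1 + cost e) p≤)

iterate : ∀ {v e} {C : Cmd v} {σ σ′ σ″ b c} → eval e σ ≢ nil →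
          ⟨ C , σ ⟩⇒ σ′ within b → ⟨ while e repeat C , σ′ ⟩⇒ σ″ within c →
          ⟨ while e repeat C , σ ⟩⇒ σ″ within (1 + cost e + b + c)
iterate {e = e} e≢ (run p p≤) (run q q≤) =
  run (loop e≢ p q) (+-mono-≤ (+-monoʳ-≤ (1 + cost e) p≤) q≤)

-- Adding a variable to a program

module _ {v : ℕ} (i : Fin (suc v)) where

  weakenExpr : Expr v → Expr (suc v)
  weakenExpr (var x)    = var (punchIn i x)
  weakenExpr (const t)  = const t
  weakenExpr (cons e f) = cons (weakenExpr e) (weakenExpr f)
  weakenExpr (hd e)     = hd (weakenExpr e)
  weakenExpr (tl e)     = tl (weakenExpr e)

  weakenCmd : Cmd v → Cmd (suc v)
  weakenCmd (x := e)                = punchIn i x := weakenExpr e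
  weakenCmd (C ⨾ D)                 = weakenCmd C ⨾ weakenCmd D
  weakenCmd (if e then C else D)    = if weakenExpr e then weakenCmd C else weakenCmd D
  weakenCmd (while e repeat C)      = while weakenExpr e repeat weakenCmd C

  cost-weaken : ∀ e → cost (weakenExpr e) ≡ cost e
  cost-weaken (var x)    = refl
  cost-weaken (const t)  = refl
  cost-weaken (cons e f) = cong suc (cong₂ _+_ (cost-weaken e) (cost-weaken f))
  cost-weaken (hd e)     = cong suc (cost-weaken e)
  cost-weaken (tl e)     = cong suc (cost-weaken e)

  module _ (s : Tree) where

    eval-weaken : ∀ e σ → eval (weakenExpr e) (insertAt σ i s) ≡ eval e σ
    eval-weaken (var x)    σ = insertAt-punchIn σ i s x
    eval-weaken (const t)  σ = refl
    eval-weaken (cons e f) σ = cong₂ _∙_ (eval-weaken e σ) (eval-weaken f σ)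
    eval-weaken (hd e)     σ = cong head (eval-weaken e σ)
    eval-weaken (tl e)     σ = cong tail (eval-weaken e σ)

insertAt-update : ∀ {v} (i : Fin (suc v)) s (σ : Store v) x t →
                  insertAt σ i s [ punchIn i x ]≔ t ≡ insertAt (σ [ x ]≔ t) i s
insertAt-update zero    s σ       x       t = refl
insertAt-update (suc i) s (u ∷ σ) zero    t = refl
insertAt-update (suc i) s (u ∷ σ) (suc x) t = cong (u ∷_) (insertAt-update i s σ x t)

retime : ∀ {v} {C : Cmd v} {σ σ′ t u} → t ≡ u → ⟨ C , σ ⟩⇓ σ′ ⟨ t ⟩ → ⟨ C , σ ⟩⇓ σ′ ⟨ u ⟩
retime refl p = p

-- The inserted variable is never mentioned by the weakened command, so its content survives the run
-- of an unknown program, at no cost in time.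
exec-weaken : ∀ {v} (i : Fin (suc v)) s {C : Cmd v} {σ σ′ t} → ⟨ C , σ ⟩⇓ σ′ ⟨ t ⟩ →
              ⟨ weakenCmd i C , insertAt σ i s ⟩⇓ insertAt σ′ i s ⟨ t ⟩
exec-weaken i s (assign {x} {e} {σ}) =
  subst₂ (⟨ punchIn i x := weakenExpr i e , insertAt σ i s ⟩⇓_⟨_⟩)
    (trans (cong (insertAt σ i s [ punchIn i x ]≔_) (eval-weaken i s e σ)) (insertAt-update i s σ x _))
    (cong suc (cost-weaken i e))
    assign
exec-weaken i s (seq p q) = seq (exec-weaken i s p) (exec-weaken i s q)
exec-weaken i s (if-yes {e} {σ = σ} {t = t} e≢ p) =
  retime (cong (λ c → 1 + c + t) (cost-weaken i e))
    (if-yes (e≢ ∘ trans (sym (eval-weaken i s e σ))) (exec-weaken i s p))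
exec-weaken i s (if-no {e} {σ = σ} {t = t} e≡ p) =
  retime (cong (λ c → 1 + c + t) (cost-weaken i e))
    (if-no (trans (eval-weaken i s e σ) e≡) (exec-weaken i s p))
exec-weaken i s (loop {e} {σ = σ} {s = t} {t = u} e≢ p q) =
  retime (cong (λ c → 1 + c + t + u) (cost-weaken i e))
    (loop (e≢ ∘ trans (sym (eval-weaken i s e σ))) (exec-weaken i s p) (exec-weaken i s q))
exec-weaken i s (exit {e} {σ = σ} e≡) =
  retime (cong suc (cost-weaken i e))
    (exit (trans (eval-weaken i s e σ) e≡))

-- Polynomial-time functions between encoded types

record Code : Set₁ where
  field
    Carrier : Set
    enc     : Carrier → Tree

open Code

bool nat rat : Code
bool = record { enc = encodeBool }
nat  = record { enc = encodeℕ }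
rat  = record { enc = encodeℚ }

infixr 4 _⊗_

_⊗_ : Code → Code → Code
A ⊗ B = record { Carrier = Carrier A × Carrier B ; enc = λ (a , b) → enc A a ∙ enc B b }

list : Code → Code
list A = record { enc = encodeList (enc A) }

-- The argument and the result are held in variable zero.  Variable one is a
-- stack, to be left as it was found; it is what makes the programs compose
-- without any allocation of variables.
record PolyTime (A B : Code) (f : Carrier A → Carrier B) : Set where
  field
    cmd    : ∀ {v} → Cmd (2 + v)
    time   : Polynomial
    growth : Polynomial
    runs   : ∀ {v} a s (ρ : Store v) →
             ⟨ cmd , enc A a ∷ s ∷ ρ ⟩⇒ enc B (f a) ∷ s ∷ ρ within ⟦ time ⟧ (size (enc A a))
    size≤  : ∀ a → size (enc B (f a)) ≤ ⟦ growth ⟧ (size (enc A a))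

open PolyTime

pattern val = zero
pattern stk = suc zero

skip : ∀ {v} → Cmd (suc v)
skip = val := var val

-- A program sees only trees, so it serves all types whose encodings agree. In this way pairs become
-- list cells, numbers become lists of bits, and formulas become lists of clauses over ℕ.
recode : ∀ {A A′ B B′ f f′} (g : Carrier A′ → Carrier A) →
         (∀ a → enc A (g a) ≡ enc A′ a) → (∀ a → enc B (f (g a)) ≡ enc B′ (f′ a)) →
         PolyTime A B f → PolyTime A′ B′ f′
recode {A} {A′} {B} {B′} {f} {f′} g enc-g enc-f P = record
  { cmd    = cmd P
  ; time   = time P
  ; growth = growth P
  ; runs   = λ a s ρ → runs′ a s ρ (runs P (g a) s ρ)
  ; size≤  = λ a → subst₂ (λ x y → size y ≤ ⟦ growth P ⟧ (size x)) (enc-g a) (enc-f a) (size≤ P (g a))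
  }
  where
  runs′ : ∀ {v} a s (ρ : Store v) →
          ⟨ cmd P , enc A (g a) ∷ s ∷ ρ ⟩⇒ enc B (f (g a)) ∷ s ∷ ρ within ⟦ time P ⟧ (size (enc A (g a))) →
          ⟨ cmd P , enc A′ a ∷ s ∷ ρ ⟩⇒ enc B′ (f′ a) ∷ s ∷ ρ within ⟦ time P ⟧ (size (enc A′ a))
  runs′ a s ρ p rewrite enc-g a | enc-f a = p

ext : ∀ {A B f g} → (∀ a → f a ≡ g a) → PolyTime A B f → PolyTime A B g
ext {B = B} f≗g = recode id (λ _ → refl) (λ a → cong (enc B) (f≗g a))

identity : ∀ {A} → PolyTime A A id
identity = record
  { cmd    = skip
  ; time   = K 2
  ; growth = X
  ; runs   = λ a s ρ → assign′
  ; size≤  = λ a → ≤-refl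
  }

constant : ∀ {A B} b → PolyTime A B (λ _ → b)
constant {A} {B} b = record
  { cmd    = val := const (enc B b)
  ; time   = K 2
  ; growth = K (size (enc B b))
  ; runs   = λ a s ρ → assign′
  ; size≤  = λ a → ≤-refl
  }

first : ∀ {A B} → PolyTime (A ⊗ B) A proj₁
first = record
  { cmd    = val := hd (var val)
  ; time   = K 3
  ; growth = X
  ; runs   = λ a s ρ → assign′
  ; size≤  = λ a → m≤n⇒m≤1+n (m≤m+n _ _)
  }

second : ∀ {A B} → PolyTime (A ⊗ B) B proj₂
second {A} = record
  { cmd    = val := tl (var val)
  ; time   = K 3
  ; growth = X
  ; runs   = λ a s ρ → assign′
  ; size≤  = λ (a , _) → m≤n⇒m≤1+n (m≤n+m _ (size (enc A a)))
  }

infixr 9 _∘ₚ_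

_∘ₚ_ : ∀ {A B C g f} → PolyTime B C g → PolyTime A B f → PolyTime A C (g ∘ f)
_∘ₚ_ {A} {f = f} Q P = record
  { cmd    = cmd P ⨾ cmd Q
  ; time   = time P ⊕ time Q ⊚ growth P
  ; growth = growth Q ⊚ growth P
  ; runs   = λ a s ρ → runs P a s ρ ▷ relax (⟦⟧-mono (time Q) (size≤ P a)) (runs Q (f a) s ρ)
  ; size≤  = λ a → ≤-trans (size≤ Q (f a)) (⟦⟧-mono (growth Q) (size≤ P a))
  }

infixr 4 _&_

-- The stack keeps the argument while `P` runs, and the result of `P` while `Q` runs.
_&_ : ∀ {A B C f g} → PolyTime A B f → PolyTime A C g → PolyTime A (B ⊗ C) (λ a → f a , g a)
P & Q = record
  { cmd    = stk := cons (var val) (var stk)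
           ⨾ cmd P
           ⨾ stk := cons (var val) (var stk)
           ⨾ val := hd (tl (var stk))
           ⨾ stk := cons (hd (var stk)) (tl (tl (var stk)))
           ⨾ cmd Q
           ⨾ val := cons (hd (var stk)) (var val)
           ⨾ stk := tl (var stk)
  ; time   = K 4 ⊕ (time P ⊕ (K 4 ⊕ (K 4 ⊕ (K 7 ⊕ (time Q ⊕ (K 5 ⊕ K 3))))))
  ; growth = K 1 ⊕ growth P ⊕ growth Q
  ; runs   = λ a s ρ →
      assign′ ▷ runs P a _ ρ ▷ assign′ ▷ assign′ ▷ assign′ ▷ runs Q a _ ρ ▷ assign′ ▷ assign′
  ; size≤  = λ a → s≤s (+-mono-≤ (size≤ P a) (size≤ Q a))
  }

ifₚ : ∀ {A B f g h} → PolyTime A bool h → PolyTime A B f → PolyTime A B g →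
      PolyTime A B (λ a → Bool.if h a then f a else g a)
ifₚ {A} {B} {f = f} {g} {h} H P Q = select ∘ₚ (H & identity)
  where
  runs′ : ∀ {v} b a s (ρ : Store v) →
    ⟨ if hd (var val) then val := tl (var val) ⨾ cmd P else (val := tl (var val) ⨾ cmd Q) ,
      (encodeBool b ∙ enc A a) ∷ s ∷ ρ ⟩⇒
      enc B (Bool.if b then f a else g a) ∷ s ∷ ρ
      within (6 + (⟦ time P ⟧ (size (encodeBool b ∙ enc A a)) + ⟦ time Q ⟧ (size (encodeBool b ∙ enc A a))))
  runs′ true  a s ρ = relax (+-monoʳ-≤ 6 (≤-trans (⟦⟧-mono (time P) (m≤n+m _ 4)) (m≤m+n _ _)))
                        (if-true (λ ()) (assign′ ▷ runs P a s ρ))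
  runs′ false a s ρ = relax (+-monoʳ-≤ 6 (≤-trans (⟦⟧-mono (time Q) (m≤n+m _ 2)) (m≤n+m _ _)))
                        (if-false refl (assign′ ▷ runs Q a s ρ))
  size≤′ : ∀ b a → size (enc B (Bool.if b then f a else g a)) ≤
           ⟦ growth P ⟧ (size (encodeBool b ∙ enc A a)) + ⟦ growth Q ⟧ (size (encodeBool b ∙ enc A a))
  size≤′ true  a = ≤-trans (size≤ P a) (≤-trans (⟦⟧-mono (growth P) (m≤n+m _ 4)) (m≤m+n _ _))
  size≤′ false a = ≤-trans (size≤ Q a) (≤-trans (⟦⟧-mono (growth Q) (m≤n+m _ 2)) (m≤n+m _ _))
  select : PolyTime (bool ⊗ A) B (λ (b , a) → Bool.if b then f a else g a)
  select = record
    { cmd    = if hd (var val) then val := tl (var val) ⨾ cmd P else (val := tl (var val) ⨾ cmd Q)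
    ; time   = K 6 ⊕ (time P ⊕ time Q)
    ; growth = growth P ⊕ growth Q
    ; runs   = λ (b , a) → runs′ b a
    ; size≤  = λ (b , a) → size≤′ b a
    }

caseList : {B C : Set} → C → (B → List B → C) → List B → C
caseList n c []       = n
caseList n c (x ∷ xs) = c x xs

-- A nonempty list has the same encoding as the pair of its head and its tail, so `S` runs on the
-- value as it stands.
caseₚ : ∀ {A B C n xs} {c : Carrier B → List (Carrier B) → Carrier A → Carrier C} → PolyTime A (list B) xs → PolyTime A C n →
        PolyTime ((B ⊗ list B) ⊗ A) C (λ ((x , xs) , a) → c x xs a) →
        PolyTime A C (λ a → caseList (n a) (λ x xs → c x xs a) (xs a))
caseₚ {A} {B} {C} {n} {c = c} XS N S = select ∘ₚ (XS & identity)
  where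
  runs′ : ∀ {v} xs a s (ρ : Store v) →
    ⟨ if hd (var val) then cmd S else (val := tl (var val) ⨾ cmd N) ,
      (enc (list B) xs ∙ enc A a) ∷ s ∷ ρ ⟩⇒ enc C (caseList (n a) (λ x xs → c x xs a) xs) ∷ s ∷ ρ
      within (6 + (⟦ time S ⟧ (size (enc (list B) xs ∙ enc A a)) + ⟦ time N ⟧ (size (enc (list B) xs ∙ enc A a))))
  runs′ []       a s ρ = relax (+-monoʳ-≤ 6 (≤-trans (⟦⟧-mono (time N) (m≤n+m _ 2)) (m≤n+m _ _)))
                           (if-false refl (assign′ ▷ runs N a s ρ))
  runs′ (x ∷ xs) a s ρ = relax (≤-trans (+-monoʳ-≤ 3 (m≤m+n _ _)) (m≤n+m _ 3))
                           (if-true (λ ()) (runs S ((x , xs) , a) s ρ))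
  size≤′ : ∀ xs a → size (enc C (caseList (n a) (λ x xs → c x xs a) xs)) ≤
           ⟦ growth S ⟧ (size (enc (list B) xs ∙ enc A a)) + ⟦ growth N ⟧ (size (enc (list B) xs ∙ enc A a))
  size≤′ []       a = ≤-trans (size≤ N a) (≤-trans (⟦⟧-mono (growth N) (m≤n+m _ 2)) (m≤n+m _ _))
  size≤′ (x ∷ xs) a = ≤-trans (size≤ S ((x , xs) , a)) (m≤m+n _ _)
  select : PolyTime (list B ⊗ A) C (λ (xs , a) → caseList (n a) (λ x xs → c x xs a) xs)
  select = record
    { cmd    = if hd (var val) then cmd S else (val := tl (var val) ⨾ cmd N)
    ; time   = K 6 ⊕ (time S ⊕ time N)
    ; growth = growth S ⊕ growth N
    ; runs   = λ (xs , a) → runs′ xs a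
    ; size≤  = λ (xs , a) → size≤′ xs a
    }

consₚ : ∀ {A B f g} → PolyTime A B f → PolyTime A (list B) g → PolyTime A (list B) (λ a → f a ∷ g a)
consₚ {A} {B} P Q = recode {A} {A} {B ⊗ list B} {list B} id (λ _ → refl) (λ _ → refl) (P & Q)

-- Iterating a polynomial-time function may double the size each time, so a
-- fold is polynomial only if the step adds to the size of the accumulator.
-- The weight is needed for binary counters: a carry turns many bits from false
-- into the longer true, while the number of bits grows by at most one.
record Additive (A B Γ : Code) (f : Carrier A → Carrier B → Carrier Γ → Carrier A) : Set where
  field
    weight      : Carrier A → ℕ
    conversion  : Polynomial
    increment   : Polynomial
    size≤weight : ∀ a → size (enc A a) ≤ weight a
    weight≤     : ∀ a → weight a ≤ ⟦ conversion ⟧ (size (enc A a))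
    weight≤+    : ∀ a b γ → weight (f a b γ) ≤
                            weight a + ⟦ increment ⟧ (size (enc B b) + size (enc Γ γ))

open Additive

additive : ∀ {A B Γ f} p →
           (∀ a b γ → size (enc A (f a b γ)) ≤ size (enc A a) + ⟦ p ⟧ (size (enc B b) + size (enc Γ γ))) →
           Additive A B Γ f
additive p size≤+ = record
  { conversion = X ; increment = p ; size≤weight = λ _ → ≤-refl ; weight≤ = λ _ → ≤-refl ; weight≤+ = size≤+ }

length≤size : ∀ {A} xs → length xs ≤ size (enc (list A) xs)
length≤size     []       = z≤n
length≤size {A} (x ∷ xs) = s≤s (≤-trans (length≤size {A} xs) (m≤n+m _ (size (enc A x))))

module _ {A B Γ f} (P : PolyTime ((A ⊗ B) ⊗ Γ) A (λ ((a , b) , γ) → f a b γ)) (F : Additive A B Γ f) where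

  private
    foldBody : ∀ {v} → Cmd (2 + v)
    -- The loop state consists of the remaining list, the accumulator and the parameter. It waits on
    -- the stack while `P` runs on the accumulator, the first element and the parameter.
    foldBody = stk := cons (var val) (var stk)
             ⨾ val := cons (cons (hd (tl (var val))) (hd (hd (var val)))) (tl (tl (var val)))
             ⨾ cmd P
             ⨾ val := cons (tl (hd (hd (var stk)))) (cons (var val) (tl (tl (hd (var stk)))))
             ⨾ stk := tl (var stk)

    -- `M` bounds a potential: the weight of the accumulator plus one increment for every element
    -- still to come. A step spends one increment, so `M` stays valid throughout the loop, and so
    -- does `m`.
    step-size : ∀ x xs a γ {m M} →
      size (enc (list B) (x ∷ xs)) + size (enc Γ γ) ≤ m →
      weight F a + length (x ∷ xs) * ⟦ increment F ⟧ m ≤ M →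
      weight F (f a x γ) + length xs * ⟦ increment F ⟧ m ≤ M
    step-size x xs a γ {m} {M} ≤m ≤M = begin
      weight F (f a x γ) + l * G m
        ≤⟨ +-monoˡ-≤ _ (weight≤+ F a x γ) ⟩
      weight F a + G (size (enc B x) + size (enc Γ γ)) + l * G m
        ≤⟨ +-monoˡ-≤ _ (+-monoʳ-≤ (weight F a) (⟦⟧-mono (increment F) x+γ≤m)) ⟩
      weight F a + G m + l * G m
        ≡⟨ +-assoc (weight F a) _ _ ⟩
      weight F a + suc l * G m
        ≤⟨ ≤M ⟩
      M ∎
      where
      open ≤-Reasoning
      G = ⟦ increment F ⟧
      l = length xs
      x+γ≤m : size (enc B x) + size (enc Γ γ) ≤ m
      x+γ≤m = ≤-trans (+-monoˡ-≤ (size (enc Γ γ)) (m≤n⇒m≤1+n (m≤m+n (size (enc B x)) _))) ≤m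

    tail-size : ∀ x xs γ {m} → size (enc (list B) (x ∷ xs)) + size (enc Γ γ) ≤ m →
                size (enc (list B) xs) + size (enc Γ γ) ≤ m
    tail-size x xs γ = ≤-trans (+-monoˡ-≤ (size (enc Γ γ)) (m≤n⇒m≤1+n (m≤n+m _ (size (enc B x)))))

    foldl-size : ∀ xs a γ {m M} →
      size (enc (list B) xs) + size (enc Γ γ) ≤ m →
      weight F a + length xs * ⟦ increment F ⟧ m ≤ M →
      size (enc A (foldl (λ a b → f a b γ) a xs)) ≤ M
    foldl-size []       a γ ≤m ≤M = ≤-trans (size≤weight F a) (≤-trans (m≤m+n _ 0) ≤M)
    foldl-size (x ∷ xs) a γ ≤m ≤M = foldl-size xs (f a x γ) γ (tail-size x xs γ ≤m) (step-size x xs a γ ≤m ≤M)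

    -- The 34 units pay for the loop test and the four assignments around `P`, which cost 3 and 4 +
    -- 12 + 12 + 3; the last 3 pay for the failing test.
    foldl-runs : ∀ {v} xs a γ s (ρ : Store v) {m M} →
      size (enc (list B) xs) + size (enc Γ γ) ≤ m →
      weight F a + length xs * ⟦ increment F ⟧ m ≤ M →
      ⟨ while hd (var val) repeat foldBody , (enc (list B) xs ∙ enc A a ∙ enc Γ γ) ∷ s ∷ ρ ⟩⇒
        (nil ∙ enc A (foldl (λ a b → f a b γ) a xs) ∙ enc Γ γ) ∷ s ∷ ρ
        within (length xs * (34 + ⟦ time P ⟧ (2 + M + m)) + 3)
    foldl-runs []       a γ s ρ ≤m ≤M = run (exit refl) ≤-refl
    foldl-runs (x ∷ xs) a γ s ρ {m} {M} ≤m ≤M =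
      relax (≤-reflexive (regroup (⟦ time P ⟧ (2 + M + m)) (length xs * (34 + ⟦ time P ⟧ (2 + M + m)) + 3)
                                  (length xs * (34 + ⟦ time P ⟧ (2 + M + m))) refl))
        (iterate (λ ())
          (assign′ ▷ assign′ ▷ relax (⟦⟧-mono (time P) input≤) (runs P ((a , x) , γ) _ ρ) ▷ assign′ ▷ assign′)
          (foldl-runs xs (f a x γ) γ s ρ (tail-size x xs γ ≤m) (step-size x xs a γ ≤m ≤M)))
      where
      regroup : ∀ t r u → r ≡ u + 3 → 3 + (4 + (12 + (t + (12 + 3)))) + r ≡ 34 + t + u + 3
      regroup t r u refl = lemma t u
        where
        lemma : ∀ t u → 3 + (4 + (12 + (t + (12 + 3)))) + (u + 3) ≡ 34 + t + u + 3
        lemma = solve-∀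
      input≤ : size ((enc A a ∙ enc B x) ∙ enc Γ γ) ≤ 2 + M + m
      input≤ = begin
        suc (suc (size (enc A a) + size (enc B x)) + size (enc Γ γ))
          ≡⟨ lemma (size (enc A a)) (size (enc B x)) (size (enc Γ γ)) ⟩
        2 + (size (enc A a) + (size (enc B x) + size (enc Γ γ)))
          ≤⟨ +-monoʳ-≤ 2 (+-mono-≤ (≤-trans (size≤weight F a) (≤-trans (m≤m+n (weight F a) _) ≤M))
              (≤-trans (+-monoˡ-≤ (size (enc Γ γ)) (m≤n⇒m≤1+n (m≤m+n (size (enc B x)) _))) ≤m)) ⟩
        2 + M + m ∎
        where
        open ≤-Reasoning
        lemma : ∀ x y z → suc (suc (x + y) + z) ≡ 2 + (x + (y + z))
        lemma = solve-∀

    module _ (xs : List (Carrier B)) (a : Carrier A) (γ : Carrier Γ) where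
      private
        input = size (enc (list B) xs ∙ enc A a ∙ enc Γ γ)
      elements≤ : size (enc (list B) xs) + size (enc Γ γ) ≤ input
      elements≤ = m≤n⇒m≤1+n (+-monoʳ-≤ (size (enc (list B) xs)) (m≤n⇒m≤1+n (m≤n+m _ (size (enc A a)))))
      accumulator≤ : weight F a + length xs * ⟦ increment F ⟧ input ≤ ⟦ conversion F ⟧ input + input * ⟦ increment F ⟧ input
      accumulator≤ = +-mono-≤
        (≤-trans (weight≤ F a) (⟦⟧-mono (conversion F)
          (m≤n⇒m≤1+n (≤-trans (m≤n⇒m≤1+n (m≤m+n _ _)) (m≤n+m _ (size (enc (list B) xs)))))))
        (*-monoˡ-≤ (⟦ increment F ⟧ input) (≤-trans (length≤size {B} xs) (m≤n⇒m≤1+n (m≤m+n _ _))))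

  foldl′ : PolyTime (list B ⊗ A ⊗ Γ) A (λ (xs , a , γ) → foldl (λ a b → f a b γ) a xs)
  foldl′ = record
    { cmd    = while hd (var val) repeat foldBody ⨾ val := hd (tl (var val))
    ; time   = (X ⊛ (K 34 ⊕ time P ⊚ (K 2 ⊕ (conversion F ⊕ X ⊛ increment F) ⊕ X)) ⊕ K 3) ⊕ K 4
    ; growth = conversion F ⊕ X ⊛ increment F
    ; runs   = λ (xs , a , γ) s ρ →
        relax (+-monoˡ-≤ 3 (*-monoˡ-≤ (34 + ⟦ time P ⟧ _) (≤-trans (length≤size {B} xs) (m≤n⇒m≤1+n (m≤m+n _ _)))))
          (foldl-runs xs a γ s ρ (elements≤ xs a γ) (accumulator≤ xs a γ))
        ▷ assign′
    ; size≤  = λ (xs , a , γ) → foldl-size xs a γ (elements≤ xs a γ) (accumulator≤ xs a γ)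
    }

foldlₚ : ∀ {A B Γ f xs z} → PolyTime ((A ⊗ B) ⊗ Γ) A (λ ((a , b) , γ) → f a b γ) → Additive A B Γ f →
         PolyTime Γ (list B) xs → PolyTime Γ A z →
         PolyTime Γ A (λ γ → foldl (λ a b → f a b γ) (z γ) (xs γ))
foldlₚ P F XS Z = foldl′ P F ∘ₚ (XS & Z & identity)

reverseₚ : ∀ {A Γ xs} → PolyTime Γ (list A) xs → PolyTime Γ (list A) (reverse ∘ xs)
reverseₚ XS = foldlₚ (consₚ (second ∘ₚ first) (first ∘ₚ first))
  (additive (K 1 ⊕ X) λ as b γ → ≤-trans (≤-reflexive (+-comm (suc _) _)) (+-monoʳ-≤ _ (s≤s (m≤m+n _ _))))
  XS (constant [])

-- The loop consumes a list from the front, so a right fold is a left fold over the reversed list.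
foldrₚ : ∀ {A B Γ f xs z} → PolyTime ((A ⊗ B) ⊗ Γ) A (λ ((a , b) , γ) → f a b γ) → Additive A B Γ f →
         PolyTime Γ (list B) xs → PolyTime Γ A z →
         PolyTime Γ A (λ γ → foldr (λ b a → f a b γ) (z γ) (xs γ))
foldrₚ {f = f} {xs} {z} P F XS Z =
  ext (λ γ → trans (sym (List.reverse-foldr (λ b a → f a b γ) (z γ) (reverse (xs γ))))
                   (cong (foldr (λ b a → f a b γ) (z γ)) (List.reverse-involutive (xs γ))))
      (foldlₚ P F (reverseₚ XS) Z)

-- Boolean functions and functions on lists

notₚ : ∀ {A f} → PolyTime A bool f → PolyTime A bool (not ∘ f)
notₚ {f = f} P = ext (λ a → lemma (f a)) (ifₚ P (constant false) (constant true))
  where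
  lemma : ∀ b → (Bool.if b then false else true) ≡ not b
  lemma true  = refl
  lemma false = refl

infixr 6 _∧ₚ_
infixr 5 _∨ₚ_

_∧ₚ_ : ∀ {A f g} → PolyTime A bool f → PolyTime A bool g → PolyTime A bool (λ a → f a ∧ g a)
_∧ₚ_ {f = f} {g} P Q = ext (λ a → lemma (f a) (g a)) (ifₚ P Q (constant false))
  where
  lemma : ∀ b c → (Bool.if b then c else false) ≡ b ∧ c
  lemma true  c = refl
  lemma false c = refl

_∨ₚ_ : ∀ {A f g} → PolyTime A bool f → PolyTime A bool g → PolyTime A bool (λ a → f a ∨ g a)
_∨ₚ_ {f = f} {g} P Q = ext (λ a → lemma (f a) (g a)) (ifₚ P (constant true) Q)
  where
  lemma : ∀ b c → (Bool.if b then true else c) ≡ b ∨ c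
  lemma true  c = refl
  lemma false c = refl

xorₚ : ∀ {A f g} → PolyTime A bool f → PolyTime A bool g → PolyTime A bool (λ a → f a xor g a)
xorₚ {f = f} {g} P Q = ext (λ a → lemma (f a) (g a)) (ifₚ P (notₚ Q) Q)
  where
  lemma : ∀ b c → (Bool.if b then not c else c) ≡ b xor c
  lemma true  c = refl
  lemma false c = refl

sizeBool≤ : ∀ b → size (encodeBool b) ≤ 3
sizeBool≤ true  = ≤-refl
sizeBool≤ false = s≤s z≤n

module _ {B Γ : Code} where

  element : ∀ {A} → PolyTime ((A ⊗ B) ⊗ Γ) (B ⊗ Γ) (λ ((_ , b) , γ) → b , γ)
  element = second ∘ₚ first & second

  module _ {xs : Carrier Γ → List (Carrier B)} where

    mapₚ : ∀ {C} {f : Carrier B → Carrier Γ → Carrier C} →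
           PolyTime (B ⊗ Γ) C (λ (b , γ) → f b γ) → PolyTime Γ (list B) xs →
           PolyTime Γ (list C) (λ γ → map (λ b → f b γ) (xs γ))
    mapₚ {C} {f} P XS = ext (λ γ → lemma (xs γ))
      (foldrₚ (consₚ (P ∘ₚ element) (first ∘ₚ first))
        (additive (K 1 ⊕ growth P ⊚ (K 1 ⊕ X)) λ cs b γ → begin
          suc (size (enc C (f b γ)) + size (enc (list C) cs))          ≡⟨ +-comm (suc (size (enc C (f b γ)))) _ ⟩
          size (enc (list C) cs) + suc (size (enc C (f b γ)))          ≤⟨ +-monoʳ-≤ (size (enc (list C) cs)) (s≤s (size≤ P (b , γ))) ⟩
          size (enc (list C) cs) + suc (⟦ growth P ⟧ (1 + (size (enc B b) + size (enc Γ γ)))) ∎)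
        XS (constant []))
      where
      open ≤-Reasoning
      lemma : ∀ {γ} ys → foldr (λ b cs → f b γ ∷ cs) [] ys ≡ map (λ b → f b γ) ys
      lemma []       = refl
      lemma (y ∷ ys) = cong (_ ∷_) (lemma ys)

    -- The programs compute `does` of the decision procedures themselves, so their answers have a
    -- meaning without further correctness proofs.
    module _ {P : Carrier B → Carrier Γ → Set} (P? : ∀ b γ → Dec (P b γ))
             (P?ₚ : PolyTime (B ⊗ Γ) bool (λ (b , γ) → does (P? b γ)))
             (XS : PolyTime Γ (list B) xs) where

      anyₚ : PolyTime Γ bool (λ γ → does (Any.any? (λ b → P? b γ) (xs γ)))
      anyₚ = ext (λ γ → lemma (xs γ))
        (foldrₚ ((P?ₚ ∘ₚ element) ∨ₚ (first ∘ₚ first))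
          (additive (K 3) λ a b γ → ≤-trans (sizeBool≤ (does (P? b γ) ∨ a)) (m≤n+m 3 _)) XS (constant false))
        where
        lemma : ∀ {γ} ys → foldr (λ b r → does (P? b γ) ∨ r) false ys ≡ does (Any.any? (λ b → P? b γ) ys)
        lemma []       = refl
        lemma (y ∷ ys) = cong (_ ∨_) (lemma ys)

      allₚ : PolyTime Γ bool (λ γ → does (All.all? (λ b → P? b γ) (xs γ)))
      allₚ = ext (λ γ → lemma (xs γ))
        (foldrₚ ((P?ₚ ∘ₚ element) ∧ₚ (first ∘ₚ first))
          (additive (K 3) λ a b γ → ≤-trans (sizeBool≤ (does (P? b γ) ∧ a)) (m≤n+m 3 _)) XS (constant true))
        where
        lemma : ∀ {γ} ys → foldr (λ b r → does (P? b γ) ∧ r) true ys ≡ does (All.all? (λ b → P? b γ) ys)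
        lemma []       = refl
        lemma (y ∷ ys) = cong (_ ∧_) (lemma ys)

      filterₚ : PolyTime Γ (list B) (λ γ → filter (λ b → P? b γ) (xs γ))
      filterₚ = ext (λ γ → lemma (xs γ))
        (foldrₚ (ifₚ (P?ₚ ∘ₚ element) (consₚ (second ∘ₚ first) (first ∘ₚ first)) (first ∘ₚ first))
          (additive (K 1 ⊕ X) λ bs b γ → step-size (does (P? b γ)) bs b γ) XS (constant []))
        where
        step-size : ∀ d bs b γ → size (enc (list B) (Bool.if d then b ∷ bs else bs)) ≤
                    size (enc (list B) bs) + (1 + (size (enc B b) + size (enc Γ γ)))
        step-size true  bs b γ = ≤-trans (≤-reflexive (+-comm (suc (size (enc B b))) _))
                                   (+-monoʳ-≤ (size (enc (list B) bs)) (s≤s (m≤m+n _ _)))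
        step-size false bs b γ = m≤m+n _ _
        lemma : ∀ {γ} ys → foldr (λ b bs → Bool.if does (P? b γ) then b ∷ bs else bs) [] ys ≡
                filter (λ b → P? b γ) ys
        lemma [] = refl
        lemma {γ} (y ∷ ys) with does (P? y γ)
        ... | true  = cong (y ∷_) (lemma ys)
        ... | false = lemma ys

size-++ : ∀ {A} xs ys → size (enc (list A) (xs ++ ys)) ≤ size (enc (list A) ys) + size (enc (list A) xs)
size-++     []       ys = m≤m+n _ 1
size-++ {A} (x ∷ xs) ys = begin
  suc (size (enc A x) + size (enc (list A) (xs ++ ys)))
    ≤⟨ +-monoʳ-≤ (suc (size (enc A x))) (size-++ {A} xs ys) ⟩
  suc (size (enc A x)) + (size (enc (list A) ys) + size (enc (list A) xs))
    ≡⟨ lemma (size (enc A x)) (size (enc (list A) ys)) (size (enc (list A) xs)) ⟩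
  size (enc (list A) ys) + suc (size (enc A x) + size (enc (list A) xs)) ∎
  where
  open ≤-Reasoning
  lemma : ∀ a b c → suc a + (b + c) ≡ b + suc (a + c)
  lemma = solve-∀

appendₚ : ∀ {A Γ xs ys} → PolyTime Γ (list A) xs → PolyTime Γ (list A) ys →
          PolyTime Γ (list A) (λ γ → xs γ ++ ys γ)
appendₚ {xs = xs} {ys} XS YS = ext (λ γ → sym (List.++-is-foldr (xs γ) (ys γ)))
  (foldrₚ (consₚ (second ∘ₚ first) (first ∘ₚ first))
    (additive (K 1 ⊕ X) λ as b γ → ≤-trans (≤-reflexive (+-comm (suc _) _)) (+-monoʳ-≤ _ (s≤s (m≤m+n _ _))))
    XS YS)

concatMapₚ : ∀ {A B Γ xs} {f : Carrier B → Carrier Γ → List (Carrier A)} →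
             PolyTime (B ⊗ Γ) (list A) (λ (b , γ) → f b γ) → PolyTime Γ (list B) xs →
             PolyTime Γ (list A) (λ γ → concatMap (λ b → f b γ) (xs γ))
concatMapₚ {A} {xs = xs} {f} P XS = ext (λ γ → lemma (xs γ))
  (foldrₚ (appendₚ (P ∘ₚ element) (first ∘ₚ first))
    (additive (growth P ⊚ (K 1 ⊕ X)) λ as b γ →
      ≤-trans (size-++ {A} (f b γ) as) (+-monoʳ-≤ (size (enc (list A) as)) (size≤ P (b , γ))))
    XS (constant []))
  where
  lemma : ∀ {γ} ys → foldr (λ b as → f b γ ++ as) [] ys ≡ concatMap (λ b → f b γ) ys
  lemma []       = refl
  lemma (y ∷ ys) = cong (_ ++_) (lemma ys)

-- Equality tests, membership and deduplication

record EqCode (A : Code) : Set where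
  field
    _≟_ : DecidableEquality (Carrier A)
    ≟ₚ  : PolyTime (A ⊗ A) bool (λ (a , b) → does (a ≟ b))

eqBool : EqCode bool
eqBool = record
  { _≟_ = Bool._≟_
  ; ≟ₚ  = ext (uncurry lemma) (notₚ (xorₚ first second))
  }
  where
  lemma : ∀ b c → not (b xor c) ≡ does (b Bool.≟ c)
  lemma true  true  = refl
  lemma true  false = refl
  lemma false true  = refl
  lemma false false = refl

module _ {A B} (EA : EqCode A) (EB : EqCode B) where
  open EqCode

  eqPair : EqCode (A ⊗ B)
  eqPair = record
    { _≟_ = λ (a , b) (c , d) → map′ (uncurry (cong₂ _,_)) ,-injective (_≟_ EA a c ×-dec _≟_ EB b d)
    ; ≟ₚ  = ≟ₚ EA ∘ₚ (first ∘ₚ first & first ∘ₚ second) ∧ₚ ≟ₚ EB ∘ₚ (second ∘ₚ first & second ∘ₚ second)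
    }

module _ {A} (E : EqCode A) where
  open EqCode E

  private
    List-≟ : DecidableEquality (List (Carrier A))
    List-≟ = List.≡-dec _≟_

    -- Two lists are compared in one fold over the first, with the second consumed inside the state.
    -- The flag drops at a mismatch or when the second list ends too early; `exhausted` rejects a
    -- remainder.
    match : Carrier A → Bool × List (Carrier A) → Bool × List (Carrier A)
    match x (b , ys) = caseList (false , []) (λ y ys → b ∧ does (x ≟ y) , ys) ys

    matchₚ : PolyTime (((bool ⊗ list A) ⊗ A) ⊗ (list A ⊗ list A)) (bool ⊗ list A) (λ ((s , x) , _) → match x s)
    matchₚ = caseₚ {A = ((bool ⊗ list A) ⊗ A) ⊗ (list A ⊗ list A)}
      {c = λ y ys ((s , x) , _) → proj₁ s ∧ does (x ≟ y) , ys}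
      (second ∘ₚ first ∘ₚ first)
      (constant (false , []))
      ((first ∘ₚ first ∘ₚ first ∘ₚ second ∧ₚ ≟ₚ ∘ₚ (second ∘ₚ first ∘ₚ second & first ∘ₚ first)) & second ∘ₚ first)

    matchAll : List (Carrier A) → Bool × List (Carrier A) → Bool × List (Carrier A)
    matchAll xs s = foldl (λ s x → match x s) s xs

    exhausted : Bool × List (Carrier A) → Bool
    exhausted (b , ys) = b ∧ caseList true (λ _ _ → false) ys

    match-spec : ∀ xs b ys → exhausted (matchAll xs (b , ys)) ≡ b ∧ does (List-≟ xs ys)
    match-spec []       b []       = refl
    match-spec []       b (y ∷ ys) = refl
    match-spec (x ∷ xs) b []       = trans (match-spec xs false []) (sym (Bool.∧-zeroʳ b))
    match-spec (x ∷ xs) b (y ∷ ys) = trans (match-spec xs (b ∧ does (x ≟ y)) ys) (Bool.∧-assoc b _ _)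

    match-size : ∀ s x → size (enc (bool ⊗ list A) (match x s)) ≤ size (enc (bool ⊗ list A) s) + 3
    match-size (b , [])     x = m≤n+m 3 (size (encodeBool b ∙ nil))
    match-size (b , y ∷ ys) x = begin
      1 + size (encodeBool (b ∧ does (x ≟ y))) + l   ≤⟨ s≤s (+-monoˡ-≤ l (sizeBool≤ (b ∧ does (x ≟ y)))) ⟩
      4 + l                                          ≡⟨ +-comm 4 l ⟩
      l + 4                                          ≡⟨ +-suc l 3 ⟩
      suc (l + 3)                                    ≤⟨ s≤s (+-monoˡ-≤ 3 l≤) ⟩
      suc (size (encodeBool b) + suc (size (enc A y) + l)) + 3 ∎
      where
      open ≤-Reasoning
      l = size (enc (list A) ys)
      l≤ : l ≤ size (encodeBool b) + suc (size (enc A y) + l)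
      l≤ = ≤-trans (m≤n⇒m≤1+n (m≤n+m l (size (enc A y)))) (m≤n+m _ (size (encodeBool b)))

  eqList : EqCode (list A)
  eqList = record
    { _≟_ = List-≟
    ; ≟ₚ  = ext (λ (xs , ys) → match-spec xs true ys)
        (caseResult ∘ₚ foldlₚ matchₚ (additive (K 3) λ s x _ → match-size s x) first (constant true & second))
    }
    where
    caseResult : PolyTime (bool ⊗ list A) bool exhausted
    caseResult = first ∧ₚ caseₚ {A = bool ⊗ list A} {n = λ _ → true} {c = λ _ _ _ → false}
      second (constant true) (constant false)

module _ {A} (E : EqCode A) where
  open EqCode E
  open import Data.List.Membership.DecPropositional _≟_ using (_∈?_)

  memberₚ : ∀ {Γ x xs} → PolyTime Γ A x → PolyTime Γ (list A) xs →
            PolyTime Γ bool (λ γ → does (x γ ∈? xs γ))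
  memberₚ P XS = anyₚ {Γ = list A ⊗ A} (λ y (_ , x) → x ≟ y) (≟ₚ ∘ₚ (second ∘ₚ second & first)) first ∘ₚ (XS & P)

  deduplicateₚ : ∀ {Γ xs} → PolyTime Γ (list A) xs → PolyTime Γ (list A) (λ γ → deduplicate _≟_ (xs γ))
  deduplicateₚ {xs = xs} XS = ext (λ γ → lemma (xs γ))
    (foldrₚ
      (consₚ (second ∘ₚ first)
        (filterₚ (λ y ((ys , x) , γ) → ¬? (x ≟ y))
          (notₚ (≟ₚ ∘ₚ (second ∘ₚ first ∘ₚ second & first))) (first ∘ₚ first)))
      (additive (K 1 ⊕ X) λ ys x γ → begin
        suc (size (enc A x) + size (enc (list A) (filter (λ y → ¬? (x ≟ y)) ys)))
          ≤⟨ +-monoʳ-≤ (suc (size (enc A x))) (size-filter (λ y → ¬? (x ≟ y)) ys) ⟩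
        suc (size (enc A x)) + size (enc (list A) ys)
          ≡⟨ +-comm (suc (size (enc A x))) _ ⟩
        size (enc (list A) ys) + suc (size (enc A x))
          ≤⟨ +-monoʳ-≤ (size (enc (list A) ys)) (s≤s (m≤m+n _ _)) ⟩
        size (enc (list A) ys) + (1 + (size (enc A x) + _)) ∎)
      XS (constant []))
    where
    open ≤-Reasoning
    size-filter : ∀ {P : Carrier A → Set} (P? : ∀ x → Dec (P x)) ys →
                  size (enc (list A) (filter P? ys)) ≤ size (enc (list A) ys)
    size-filter P? []       = ≤-refl
    size-filter P? (y ∷ ys) with does (P? y)
    ... | true  = s≤s (+-monoʳ-≤ (size (enc A y)) (size-filter P? ys))
    ... | false = ≤-trans (size-filter P? ys) (m≤n⇒m≤1+n (m≤n+m _ (size (enc A y))))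
    lemma : ∀ ys → foldr (λ x r → x ∷ filter (λ y → ¬? (x ≟ y)) r) [] ys ≡ deduplicate _≟_ ys
    lemma []       = refl
    lemma (y ∷ ys) = cong (λ r → y ∷ filter (λ z → ¬? (y ≟ z)) r) (lemma ys)

-- Binary numbers

-- This is bijective base two, least significant digit first, with `true` for the digit 1 and
-- `false` for the digit 2. Every number has exactly one representation, so comparing bits decides
-- equality.
bits : ℕᵇ → List Bool
bits Bin.zero   = []
bits 2[1+ n ] = false ∷ bits n
bits 1+[2 n ] = true ∷ bits n

bits-injective : ∀ {m n} → bits m ≡ bits n → m ≡ n
bits-injective {Bin.zero}   {Bin.zero}   _  = refl
bits-injective {2[1+ m ]} {2[1+ n ]} eq = cong 2[1+_] (bits-injective (List.∷-injectiveʳ eq))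
bits-injective {1+[2 m ]} {1+[2 n ]} eq = cong 1+[2_] (bits-injective (List.∷-injectiveʳ eq))

enc-bits : ∀ n → enc (list bool) (bits n) ≡ encodeℕᵇ n
enc-bits Bin.zero   = refl
enc-bits 2[1+ n ] = cong (nil ∙_) (enc-bits n)
enc-bits 1+[2 n ] = cong ((nil ∙ nil) ∙_) (enc-bits n)

binary : ℕ → List Bool
binary = bits ∘ Bin.fromℕ

fromℕ-suc : ∀ n → Bin.fromℕ (suc n) ≡ Bin.suc (Bin.fromℕ n)
fromℕ-suc n = trans (Bin.fromℕ≡fromℕ' (suc n)) (cong Bin.suc (sym (Bin.fromℕ≡fromℕ' n)))

eqNat : EqCode nat
eqNat = record
  { _≟_ = λ m n → map′ (Bin.fromℕ-injective ∘ bits-injective) (cong binary)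
                    (EqCode._≟_ (eqList eqBool) (binary m) (binary n))
  ; ≟ₚ  = recode (λ (m , n) → binary m , binary n)
      (λ (m , n) → cong₂ _∙_ (enc-bits (Bin.fromℕ m)) (enc-bits (Bin.fromℕ n))) (λ _ → refl)
      (EqCode.≟ₚ (eqList eqBool))
  }

-- The state consists of the carry and the reversed sum.
increment-step : Bool × List Bool → Bool → Bool × List Bool
increment-step (carry , sum) b = carry ∧ not b , (carry xor b) ∷ sum

increment-finish : Bool × List Bool → List Bool
increment-finish (carry , sum) = reverse (Bool.if carry then true ∷ sum else sum)

increment-no-carry : ∀ sum bs → increment-finish (foldl increment-step (false , sum) bs) ≡ sum List.ʳ++ bs
increment-no-carry sum []       = refl
increment-no-carry sum (b ∷ bs) = increment-no-carry (b ∷ sum) bs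

-- Adding 1 to the digit 2 leaves the digit 1 and carries on; adding 1 to the digit 1 gives 2 and
-- ends the carry. A carry past the last digit appends the digit 1.
increment-carry : ∀ sum n → increment-finish (foldl increment-step (true , sum) (bits n)) ≡ sum List.ʳ++ bits (Bin.suc n)
increment-carry sum Bin.zero   = refl
increment-carry sum 2[1+ n ] = increment-carry (true ∷ sum) n
increment-carry sum 1+[2 n ] = increment-no-carry (false ∷ sum) (bits n)

sucₚ : PolyTime nat nat suc
sucₚ = recode binary (λ n → enc-bits (Bin.fromℕ n))
  (λ n → trans (cong (enc (list bool)) (increment-carry [] (Bin.fromℕ n)))
          (trans (enc-bits (Bin.suc (Bin.fromℕ n))) (cong encodeℕᵇ (sym (fromℕ-suc n)))))
  (finish ∘ₚ foldlₚ step (additive (K 4) (λ s b _ → step-size s b)) identity (constant (true , [])))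
  where
  step : PolyTime (((bool ⊗ list bool) ⊗ bool) ⊗ list bool) (bool ⊗ list bool) (λ ((s , b) , _) → increment-step s b)
  step = ((first ∘ₚ first ∘ₚ first) ∧ₚ notₚ (second ∘ₚ first)) &
         consₚ (xorₚ (first ∘ₚ first ∘ₚ first) (second ∘ₚ first)) (second ∘ₚ first ∘ₚ first)
  finish : PolyTime (bool ⊗ list bool) (list bool) increment-finish
  finish = reverseₚ (ifₚ first (consₚ (constant true) second) second)
  step-size : ∀ s b → size (enc (bool ⊗ list bool) (increment-step s b)) ≤ size (enc (bool ⊗ list bool) s) + 4
  step-size (true  , sum) true  = m≤m+n _ 4
  step-size (true  , sum) false = ≤-reflexive (lemma (size (enc (list bool) sum)))
    where
    lemma : ∀ n → 8 + n ≡ 4 + n + 4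
    lemma = solve-∀
  step-size (false , sum) b = s≤s (s≤s (≤-trans (s≤s (+-monoˡ-≤ _ (sizeBool≤ b))) (≤-reflexive (+-comm 4 _))))

-- Each bit is charged as if it were `true`, with three nodes and the cell that holds it.
binaryWeight : ℕ → ℕ
binaryWeight n = 1 + 4 * length (binary n)

size≤binaryWeight : ∀ n → size (encodeℕ n) ≤ binaryWeight n
size≤binaryWeight n = subst (λ t → size t ≤ binaryWeight n) (enc-bits (Bin.fromℕ n)) (lemma (binary n))
  where
  open ≤-Reasoning
  lemma : ∀ bs → size (enc (list bool) bs) ≤ 1 + 4 * length bs
  lemma []       = ≤-refl
  lemma (b ∷ bs) = begin
    suc (size (encodeBool b) + size (enc (list bool) bs)) ≤⟨ s≤s (+-mono-≤ (sizeBool≤ b) (lemma bs)) ⟩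
    4 + (1 + 4 * length bs)                               ≡⟨ cong suc (sym (*-suc 4 (length bs))) ⟩
    1 + 4 * suc (length bs)                               ∎

binaryWeight≤ : ∀ n → binaryWeight n ≤ 1 + 4 * size (encodeℕ n)
binaryWeight≤ n = s≤s (*-monoʳ-≤ 4 (subst (λ t → length (binary n) ≤ size t) (enc-bits (Bin.fromℕ n)) (length≤size {bool} (binary n))))

binaryWeight-suc : ∀ n → binaryWeight (suc n) ≤ binaryWeight n + 4
binaryWeight-suc n = begin
  1 + 4 * length (bits (Bin.fromℕ (suc n)))  ≡⟨ cong (λ m → 1 + 4 * length (bits m)) (fromℕ-suc n) ⟩
  1 + 4 * length (bits (Bin.suc (Bin.fromℕ n))) ≤⟨ s≤s (*-monoʳ-≤ 4 (lemma (Bin.fromℕ n))) ⟩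
  1 + 4 * suc (length (binary n))             ≡⟨ cong suc (trans (*-suc 4 _) (+-comm 4 _)) ⟩
  binaryWeight n + 4                          ∎
  where
  open ≤-Reasoning
  lemma : ∀ n → length (bits (Bin.suc n)) ≤ suc (length (bits n))
  lemma Bin.zero   = ≤-refl
  lemma 2[1+ n ] = s≤s (lemma n)
  lemma 1+[2 n ] = n≤1+n _

lengthₚ : ∀ {A Γ xs} → PolyTime Γ (list A) xs → PolyTime Γ nat (length ∘ xs)
lengthₚ {xs = xs} XS = ext (λ γ → lemma (xs γ))
  (foldrₚ (sucₚ ∘ₚ first ∘ₚ first) counter XS (constant 0))
  where
  counter : ∀ {B Γ} → Additive nat B Γ (λ n _ _ → suc n)
  counter = record
    { weight = binaryWeight ; conversion = K 1 ⊕ K 4 ⊛ X ; increment = K 4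
    ; size≤weight = size≤binaryWeight ; weight≤ = binaryWeight≤ ; weight≤+ = λ n _ _ → binaryWeight-suc n }
  lemma : ∀ {A : Set} (ys : List A) → foldr (λ _ → suc) 0 ys ≡ length ys
  lemma []       = refl
  lemma (y ∷ ys) = cong suc (lemma ys)

-- Natural numbers as rational distances

toℚ : ℕ → ℚ
toℚ n = ℤ.+ n ℚ./ 1

toℚᵘ-toℚ : ∀ n → ℚ.toℚᵘ (toℚ n) ℚᵘ.≃ ℚᵘ.mkℚᵘ (ℤ.+ n) 0
toℚᵘ-toℚ n = ℚ.toℚᵘ-fromℚᵘ (ℚᵘ.mkℚᵘ (ℤ.+ n) 0)

toℚ-+ : ∀ m n → toℚ (m + n) ≡ toℚ m ℚ.+ toℚ n
toℚ-+ m n = ℚ.toℚᵘ-injective (begin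
  ℚ.toℚᵘ (toℚ (m + n))                               ≈⟨ toℚᵘ-toℚ (m + n) ⟩
  ℚᵘ.mkℚᵘ (ℤ.+ (m + n)) 0                            ≈⟨ ℚᵘ.*≡* (cong (ℤ._* ℤ.+ 1)
                                                          (sym (cong₂ ℤ._+_ (ℤ.*-identityʳ (ℤ.+ m)) (ℤ.*-identityʳ (ℤ.+ n))))) ⟩
  ℚᵘ.mkℚᵘ (ℤ.+ m) 0 ℚᵘ.+ ℚᵘ.mkℚᵘ (ℤ.+ n) 0           ≈⟨ ℚᵘ.+-cong (toℚᵘ-toℚ m) (toℚᵘ-toℚ n) ⟨
  ℚ.toℚᵘ (toℚ m) ℚᵘ.+ ℚ.toℚᵘ (toℚ n)                 ≈⟨ ℚ.toℚᵘ-homo-+ (toℚ m) (toℚ n) ⟨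
  ℚ.toℚᵘ (toℚ m ℚ.+ toℚ n)                           ∎)
  where open import Relation.Binary.Reasoning.Setoid ℚᵘ.≃-setoid

toℚ-mono : ∀ {m n} → m ≤ n → toℚ m ℚ.≤ toℚ n
toℚ-mono {m} {n} m≤n = ℚ.toℚᵘ-cancel-≤
  (ℚᵘ.≤-respˡ-≃ (ℚᵘ.≃-sym (toℚᵘ-toℚ m)) (ℚᵘ.≤-respʳ-≃ (ℚᵘ.≃-sym (toℚᵘ-toℚ n))
    (ℚᵘ.*≤* (ℤ.*-monoʳ-≤-nonNeg (ℤ.+ 1) (ℤ.+≤+ m≤n)))))

toℚ-cancel : ∀ {m n} → toℚ m ℚ.≤ toℚ n → m ≤ n
toℚ-cancel {m} {n} m≤n with ℚᵘ.≤-respˡ-≃ (toℚᵘ-toℚ m) (ℚᵘ.≤-respʳ-≃ (toℚᵘ-toℚ n) (ℚ.toℚᵘ-mono-≤ m≤n))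
... | ℚᵘ.*≤* p = ℤ.drop‿+≤+ (ℤ.*-cancelʳ-≤-pos (ℤ.+ m) (ℤ.+ n) (ℤ.+ 1) p)

sumℚ-toℚ : ∀ {A : Set} (f : A → ℕ) xs → sumℚ (map (toℚ ∘ f) xs) ≡ toℚ (sum (map f xs))
sumℚ-toℚ f []       = refl
sumℚ-toℚ f (x ∷ xs) = trans (cong (toℚ (f x) ℚ.+_) (sumℚ-toℚ f xs)) (sym (toℚ-+ (f x) _))

-- Sums over clusters

sum-map-cong : ∀ {A : Set} {f g : A → ℕ} → (∀ a → f a ≡ g a) → ∀ xs → sum (map f xs) ≡ sum (map g xs)
sum-map-cong f≗g xs = cong sum (List.map-cong f≗g xs)

sum-map-0 : ∀ {A : Set} (xs : List A) → sum (map (λ _ → 0) xs) ≡ 0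
sum-map-0 []       = refl
sum-map-0 (x ∷ xs) = sum-map-0 xs

sum-map-+ : ∀ {A : Set} (f g : A → ℕ) xs → sum (map (λ a → f a + g a) xs) ≡ sum (map f xs) + sum (map g xs)
sum-map-+ f g []       = refl
sum-map-+ f g (x ∷ xs) rewrite sum-map-+ f g xs = lemma (f x) (g x) (sum (map f xs)) (sum (map g xs))
  where
  lemma : ∀ a b c d → a + b + (c + d) ≡ a + c + (b + d)
  lemma = solve-∀

sum-allFin-suc : ∀ {k} (f : Fin (suc k) → ℕ) → sum (map f (allFin (suc k))) ≡ f zero + sum (map (f ∘ suc) (allFin k))
sum-allFin-suc f = cong (λ xs → f zero + sum xs)
  (trans (List.map-tabulate suc f) (sym (List.map-tabulate id (f ∘ suc))))

sum-indicator : ∀ {k} (j : Fin k) (h : Fin k → ℕ) →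
                sum (map (λ i → Bool.if does (j Fin.≟ i) then h i else 0) (allFin k)) ≡ h j
sum-indicator {suc k} zero h =
  trans (sum-allFin-suc (λ i → Bool.if does (zero Fin.≟ i) then h i else 0))
    (trans (cong (h zero +_) (sum-map-0 (allFin k))) (+-identityʳ _))
sum-indicator (suc j) h =
  trans (sum-allFin-suc (λ i → Bool.if does (suc j Fin.≟ i) then h i else 0)) (sum-indicator j (h ∘ suc))

-- The first element `x` contributes to the fibre over `c x` only, and `sum-indicator` extracts that
-- single term.
sum-fibres : ∀ {A : Set} {k} (c : A → Fin k) (g : Fin k → A → ℕ) xs →
             sum (map (λ i → sum (map (g i) (filter (λ x → c x Fin.≟ i) xs))) (allFin k)) ≡
             sum (map (λ x → g (c x) x) xs)
sum-fibres {k = k} c g []       = sum-map-0 (allFin k)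
sum-fibres {k = k} c g (x ∷ xs) = begin
  sum (map (λ i → sum (map (g i) (filter (λ y → c y Fin.≟ i) (x ∷ xs)))) (allFin k))
    ≡⟨ sum-map-cong split (allFin k) ⟩
  sum (map (λ i → (Bool.if does (c x Fin.≟ i) then g i x else 0) + rest i) (allFin k))
    ≡⟨ sum-map-+ (λ i → Bool.if does (c x Fin.≟ i) then g i x else 0) rest (allFin k) ⟩
  sum (map (λ i → Bool.if does (c x Fin.≟ i) then g i x else 0) (allFin k)) + sum (map rest (allFin k))
    ≡⟨ cong₂ _+_ (sum-indicator (c x) (λ i → g i x)) (sum-fibres c g xs) ⟩
  g (c x) x + sum (map (λ y → g (c y) y) xs) ∎
  where
  open ≡.≡-Reasoning
  rest : Fin k → ℕ
  rest i = sum (map (g i) (filter (λ y → c y Fin.≟ i) xs))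
  split : ∀ i → sum (map (g i) (filter (λ y → c y Fin.≟ i) (x ∷ xs))) ≡
                (Bool.if does (c x Fin.≟ i) then g i x else 0) + rest i
  split i with does (c x Fin.≟ i)
  ... | true  = refl
  ... | false = refl

module _ {A : Set} (f : A → ℕ) where

  private
    zeros : List A → List A
    zeros = filter (λ x → f x ℕ.≟ 0)

  -- Each element either is counted among the zeros or adds at least one to the sum. In the next two
  -- lemmas, a value of 2 makes the inequality strict, and values of at most 1 reverse it.
  length≤sum+zeros : ∀ xs → length xs ≤ sum (map f xs) + length (zeros xs)
  length≤sum+zeros []       = z≤n
  length≤sum+zeros (x ∷ xs) with f x
  ... | zero  = ≤-trans (s≤s (length≤sum+zeros xs)) (≤-reflexive (sym (+-suc _ _)))
  ... | suc m = s≤s (≤-trans (length≤sum+zeros xs) (+-monoˡ-≤ _ (m≤n+m _ m)))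

  length<sum+zeros : ∀ {x xs} → x ∈ xs → 2 ≤ f x → length xs < sum (map f xs) + length (zeros xs)
  length<sum+zeros {xs = x ∷ xs} (here refl) 2≤ with f x
  ... | suc (suc m) = s≤s (s≤s (≤-trans (length≤sum+zeros xs) (+-monoˡ-≤ _ (m≤n+m _ m))))
  ... | suc zero    = contradiction 2≤ λ { (s≤s ()) }
  length<sum+zeros {xs = x ∷ xs} (there y∈xs) 2≤ with f x
  ... | zero  = ≤-trans (s≤s (length<sum+zeros y∈xs 2≤)) (≤-reflexive (sym (+-suc _ _)))
  ... | suc m = s≤s (≤-trans (length<sum+zeros y∈xs 2≤) (+-monoˡ-≤ _ (m≤n+m _ m)))

  sum+zeros≤length : (∀ x → f x ≤ 1) → ∀ xs → sum (map f xs) + length (zeros xs) ≤ length xs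
  sum+zeros≤length f≤1 []       = z≤n
  sum+zeros≤length f≤1 (x ∷ xs) with f x | f≤1 x
  ... | zero     | _ = ≤-trans (≤-reflexive (+-suc _ _)) (s≤s (sum+zeros≤length f≤1 xs))
  ... | suc zero | _ = s≤s (sum+zeros≤length f≤1 xs)
  ... | suc (suc _) | s≤s ()

lookup-injective : ∀ {A : Set} {xs : List A} → Unique xs → Injective _≡_ _≡_ (lookup xs)
lookup-injective (x≢ ∷ _) {zero}  {zero}  _  = refl
lookup-injective (x≢ ∷ _) {zero}  {suc j} eq = contradiction eq (All.lookup x≢ (∈-lookup j))
lookup-injective (x≢ ∷ _) {suc i} {zero}  eq = contradiction (sym eq) (All.lookup x≢ (∈-lookup i))
lookup-injective (_ ∷ !xs) {suc i} {suc j} eq = cong suc (lookup-injective !xs eq)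

-- Punching a missed value out of the target would inject `suc k` elements into `k`.
injective⇒surjective : ∀ {k} {f : Fin k → Fin k} → Injective _≡_ _≡_ f → ∀ j → ∃ λ i → f i ≡ j
injective⇒surjective {suc k} {f} inj j with Fin.any? (λ i → f i Fin.≟ j)
... | yes found = found
... | no missed = contradiction
  (Fin.injective⇒≤ {f = λ i → punchOut (λ j≡fi → missed (i , sym j≡fi))}
    (λ eq → inj (Fin.punchOut-injective (λ j≡fi → missed (_ , sym j≡fi)) (λ j≡fi → missed (_ , sym j≡fi)) eq)))
  ℕ.1+n≰n

-- The cost of a solution when distances are natural numbers

module _ (I : KMedianInstance) where
  open KMedianInstance I
  open Solution

  module _ (δ : Fin n → Fin n → ℕ) (d≡δ : ∀ i j → d i j ≡ toℚ (δ i j))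
           (δ≡0 : ∀ {i j} → δ i j ≡ 0 → i ≡ j) (S : Solution I) where

    distance : Fin n → ℕ
    distance x = δ (center S (cluster S x)) x

    totalDistance : ℕ
    totalDistance = sum (map distance (allFin n))

    clusteringCost≡ : clusteringCost I S ≡ toℚ totalDistance
    clusteringCost≡ = begin
      sumℚ (map (λ i → sumℚ (map (d (center S i)) (members I S i))) (allFin k))
        ≡⟨ cong sumℚ (List.map-cong (λ i → trans (cong sumℚ (List.map-cong (d≡δ (center S i)) (members I S i)))
                                                 (sumℚ-toℚ (δ (center S i)) (members I S i))) (allFin k)) ⟩
      sumℚ (map (λ i → toℚ (sum (map (δ (center S i)) (members I S i)))) (allFin k))
        ≡⟨ sumℚ-toℚ (λ i → sum (map (δ (center S i)) (members I S i))) (allFin k) ⟩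
      toℚ (sum (map (λ i → sum (map (δ (center S i)) (members I S i))) (allFin k)))
        ≡⟨ cong toℚ (sum-fibres (cluster S) (λ i → δ (center S i)) (allFin n)) ⟩
      toℚ totalDistance ∎
      where open ≡.≡-Reasoning

    private
      zeros : List (Fin n)
      zeros = filter (λ x → distance x ℕ.≟ 0) (allFin n)

      length-allFin : length (allFin n) ≡ n
      length-allFin = List.length-tabulate id

      -- A point at distance zero is the center of its own cluster, so different such points lie in
      -- different clusters.
      zeros≤k : length zeros ≤ k
      zeros≤k = Fin.injective⇒≤ {f = λ i → cluster S (lookup zeros i)} λ {i} {j} eq →
        lookup-injective (Unique.filter⁺ (λ x → distance x ℕ.≟ 0) (Unique.allFin⁺ n))
          (trans (sym (self i)) (trans (cong (center S) eq) (self j)))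
        where
        self : ∀ i → center S (cluster S (lookup zeros i)) ≡ lookup zeros i
        self i = δ≡0 (proj₂ (∈-filter⁻ (λ x → distance x ℕ.≟ 0) {xs = allFin n} (∈-lookup i)))

    -- At most k points are at distance zero from their center, so the others
    -- have to share a total of n − k.
    cheap⇒distance≤1 : totalDistance + k ≤ n → ∀ x → distance x ≤ 1
    cheap⇒distance≤1 cheap x = ≮⇒≥ λ 2≤ → <-irrefl refl (begin-strict
      n                              ≡⟨ length-allFin ⟨
      length (allFin n)              <⟨ length<sum+zeros distance (∈-allFin x) 2≤ ⟩
      totalDistance + length zeros   ≤⟨ +-monoʳ-≤ totalDistance zeros≤k ⟩
      totalDistance + k              ≤⟨ cheap ⟩
      n                              ∎)
      where open ≤-Reasoning

    -- The `k` centers are distinct points that cost nothing, and each remaining point costs at most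
    -- 1.
    distance≤1⇒cheap : (∀ i → distance (center S i) ≡ 0) → (∀ x → distance x ≤ 1) → totalDistance + k ≤ n
    distance≤1⇒cheap center≡0 ≤1 = begin
      totalDistance + k            ≤⟨ +-monoʳ-≤ totalDistance (Fin.injective⇒≤ position-injective) ⟩
      totalDistance + length zeros ≤⟨ sum+zeros≤length distance ≤1 (allFin n) ⟩
      length (allFin n)            ≡⟨ length-allFin ⟩
      n                            ∎
      where
      open ≤-Reasoning
      center∈zeros : ∀ i → center S i ∈ zeros
      center∈zeros i = ∈-filter⁺ (λ x → distance x ℕ.≟ 0) (∈-allFin (center S i)) (center≡0 i)
      position-injective : Injective _≡_ _≡_ (λ i → index (center∈zeros i))
      position-injective {i} {j} eq = center-injective S
        (trans (Any.lookup-index (center∈zeros i)) (trans (cong (lookup zeros) eq) (sym (Any.lookup-index (center∈zeros j)))))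

-- The reduction

literal clause point : Code
literal = bool ⊗ nat
clause  = list literal
point   = bool ⊗ clause

eqClause : EqCode clause
eqClause = eqList (eqPair eqBool eqNat)

eqPoint : EqCode point
eqPoint = eqPair eqBool eqClause

Literal′ Clause Point : Set
Literal′ = Carrier literal
Clause   = Carrier clause
Point    = Carrier point

open EqCode eqPoint using () renaming (_≟_ to _≟ₚₜ_)
open EqCode (eqPair eqBool eqNat) using () renaming (_≟_ to _≟ₗ_)
open EqCode eqNat using () renaming (_≟_ to _≟ₙ_)
open import Data.List.Membership.DecPropositional _≟ₚₜ_ using () renaming (_∈?_ to _∈ₚₜ?_)
open import Data.List.Membership.DecPropositional _≟ₗ_ using () renaming (_∈?_ to _∈ₗ?_)
open import Data.List.Membership.DecPropositional _≟ₙ_ using () renaming (_∈?_ to _∈ₙ?_)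

-- A point is a literal l, encoded as (true , [ l ]), or a clause c, encoded as
-- (false , c).
literalPoint : Literal′ → Point
literalPoint l = true , [ l ]

clausePoint : Clause → Point
clausePoint c = false , c

tautology : ℕ → Clause
tautology x = (true , x) ∷ (false , x) ∷ []

gadget : ℕ → List Point
gadget x = literalPoint (true , x) ∷ literalPoint (false , x) ∷ clausePoint (tautology x) ∷ []

-- In a point that is a literal `c` is a singleton; quantifying over its elements avoids having to
-- extract the literal.
Covers : Point → Point → Set
Covers (s , c) (t , c′) = s ≡ true × (t ≡ true ⊎ Any (_∈ c′) c)

covers? : ∀ p q → Dec (Covers p q)
covers? (s , c) (t , c′) = (s Bool.≟ true) ×-dec ((t Bool.≟ true) ⊎-dec Any.any? (_∈ₗ? c′) c)

adjacent? : ∀ p q → Dec (Covers p q ⊎ Covers q p)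
adjacent? p q = covers? p q ⊎-dec covers? q p

-- The metric

opaque

  δ : Point → Point → ℕ
  δ p q = Bool.if does (p ≟ₚₜ q) then 0 else (Bool.if does (adjacent? p q) then 1 else 2)

data Distance (p q : Point) : ℕ → Set where
  same : p ≡ q → Distance p q 0
  near : p ≢ q → Covers p q ⊎ Covers q p → Distance p q 1
  far  : p ≢ q → ¬ (Covers p q ⊎ Covers q p) → Distance p q 2

opaque
  unfolding δ

  distance-δ : ∀ p q → Distance p q (δ p q)
  distance-δ p q = classify (p ≟ₚₜ q) (adjacent? p q)
    where
    classify : ∀ (e : Dec (p ≡ q)) (a : Dec (Covers p q ⊎ Covers q p)) →
               Distance p q (Bool.if does e then 0 else (Bool.if does a then 1 else 2))
    classify (yes p≡q) _          = same p≡q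
    classify (no p≢q)  (yes adj)  = near p≢q adj
    classify (no p≢q)  (no ¬adj) = far p≢q ¬adj

δ-unique : ∀ {p q m n} → Distance p q m → Distance p q n → m ≡ n
δ-unique (same _)     (same _)     = refl
δ-unique (same p≡q)   (near p≢q _) = contradiction p≡q p≢q
δ-unique (same p≡q)   (far p≢q _)  = contradiction p≡q p≢q
δ-unique (near p≢q _) (same p≡q)   = contradiction p≡q p≢q
δ-unique (near _ _)   (near _ _)   = refl
δ-unique (near _ a)   (far _ ¬a)   = contradiction a ¬a
δ-unique (far p≢q _)  (same p≡q)   = contradiction p≡q p≢q
δ-unique (far _ ¬a)   (near _ a)   = contradiction a ¬a
δ-unique (far _ _)    (far _ _)    = refl

δ-refl : ∀ p → δ p p ≡ 0
δ-refl p = δ-unique (distance-δ p p) (same refl)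

δ-sym : ∀ p q → δ p q ≡ δ q p
δ-sym p q = δ-unique (distance-δ p q) (flipped (distance-δ q p))
  where
  flipped : ∀ {m} → Distance q p m → Distance p q m
  flipped (same q≡p)     = same (sym q≡p)
  flipped (near q≢p adj)  = near (q≢p ∘ sym) (Sum.swap adj)
  flipped (far q≢p ¬adj) = far (q≢p ∘ sym) (¬adj ∘ Sum.swap)

δ≡0⇒≡ : ∀ {p q} → δ p q ≡ 0 → p ≡ q
δ≡0⇒≡ {p} {q} = lemma (distance-δ p q)
  where
  lemma : ∀ {m} → Distance p q m → m ≡ 0 → p ≡ q
  lemma (same p≡q) _ = p≡q

δ≤2 : ∀ p q → δ p q ≤ 2
δ≤2 p q = lemma (distance-δ p q)
  where
  lemma : ∀ {m} → Distance p q m → m ≤ 2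
  lemma (same _)   = z≤n
  lemma (near _ _) = s≤s z≤n
  lemma (far _ _)  = ≤-refl

-- Distances between distinct points are 1 or 2, so the sum of any two is at least the largest
-- possible distance.
δ-triangle : ∀ p q r → δ p r ≤ δ p q + δ q r
δ-triangle p q r = lemma (p ≟ₚₜ q) (q ≟ₚₜ r)
  where
  lemma : Dec (p ≡ q) → Dec (q ≡ r) → δ p r ≤ δ p q + δ q r
  lemma (yes refl) _          = m≤n+m _ (δ p p)
  lemma (no _)     (yes refl) = m≤m+n _ (δ q q)
  lemma (no p≢q)   (no q≢r)   = ≤-trans (δ≤2 p r) (+-mono-≤ (n≢0⇒n>0 (p≢q ∘ δ≡0⇒≡)) (n≢0⇒n>0 (q≢r ∘ δ≡0⇒≡)))

δ≤1⇒near : ∀ {p q} → δ p q ≤ 1 → p ≡ q ⊎ Covers p q ⊎ Covers q p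
δ≤1⇒near {p} {q} = lemma (distance-δ p q)
  where
  lemma : ∀ {m} → Distance p q m → m ≤ 1 → p ≡ q ⊎ Covers p q ⊎ Covers q p
  lemma (same p≡q)   _        = inj₁ p≡q
  lemma (near _ adj) _        = inj₂ adj
  lemma (far _ _)    (s≤s ())

covers⇒δ≤1 : ∀ {p q} → Covers p q → δ p q ≤ 1
covers⇒δ≤1 {p} {q} cov = lemma (distance-δ p q)
  where
  lemma : ∀ {m} → Distance p q m → m ≤ 1
  lemma (same _)     = z≤n
  lemma (near _ _)   = ≤-refl
  lemma (far _ ¬adj) = contradiction (inj₁ cov) ¬adj

-- The k-median instance of a formula

module Reduction (φ : List Clause) where

  opaque

    -- The variable 0 is there to make k positive.
    variables : List ℕ
    variables = deduplicate _≟ₙ_ (0 ∷ concatMap (map proj₂) φ)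

    -- Repeated clauses have to be merged, because distinct points of a metric space have positive
    -- distance. A clause of `φ` equal to some `tautology x` is merged with the one in the gadget.
    points : List Point
    points = deduplicate _≟ₚₜ_ (concatMap gadget variables ++ map clausePoint φ)

  n k : ℕ
  n = length points
  k = length variables

  pointAt : Fin n → Point
  pointAt = lookup points

  variableAt : Fin k → ℕ
  variableAt = lookup variables

  data IsPoint : Point → Set where
    isLiteral   : ∀ {b x} → x ∈ variables → IsPoint (literalPoint (b , x))
    isTautology : ∀ {x} → x ∈ variables → IsPoint (clausePoint (tautology x))
    isClause    : ∀ {c} → c ∈ φ → IsPoint (clausePoint c)

  opaque
    unfolding variables points

    variable∈ : ∀ {b x c} → c ∈ φ → (b , x) ∈ c → x ∈ variables
    variable∈ c∈φ l∈c = ∈-deduplicate⁺ _≟ₙ_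
      (there (∈-concatMap⁺ (map proj₂) (Any.map (λ { refl → ∈-map⁺ proj₂ l∈c }) c∈φ)))

    gadget∈ : ∀ {p x} → x ∈ variables → p ∈ gadget x → p ∈ points
    gadget∈ x∈ p∈ = ∈-deduplicate⁺ _≟ₚₜ_ (∈-++⁺ˡ (∈-concatMap⁺ gadget (Any.map (λ { refl → p∈ }) x∈)))

    isPoint⇒∈ : ∀ {p} → IsPoint p → p ∈ points
    isPoint⇒∈ (isLiteral {true}  x∈) = gadget∈ x∈ (here refl)
    isPoint⇒∈ (isLiteral {false} x∈) = gadget∈ x∈ (there (here refl))
    isPoint⇒∈ (isTautology x∈)       = gadget∈ x∈ (there (there (here refl)))
    isPoint⇒∈ (isClause c∈φ)         =
      ∈-deduplicate⁺ _≟ₚₜ_ (∈-++⁺ʳ (concatMap gadget variables) (∈-map⁺ clausePoint c∈φ))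

    ∈⇒isPoint : ∀ {p} → p ∈ points → IsPoint p
    ∈⇒isPoint p∈ with ∈-++⁻ (concatMap gadget variables) (∈-deduplicate⁻ _≟ₚₜ_ _ p∈)
    ... | inj₁ p∈gadgets with find (∈-concatMap⁻ gadget {xs = variables} p∈gadgets)
    ...   | x , x∈ , here refl                 = isLiteral x∈
    ...   | x , x∈ , there (here refl)         = isLiteral x∈
    ...   | x , x∈ , there (there (here refl)) = isTautology x∈
    ∈⇒isPoint p∈ | inj₂ p∈clauses with ∈-map⁻ clausePoint p∈clauses
    ...   | c , c∈φ , refl = isClause c∈φ

    pointAt-injective : Injective _≡_ _≡_ pointAt
    pointAt-injective = lookup-injective (deduplicate-! _≟ₚₜ_ (concatMap gadget variables ++ map clausePoint φ))

    variableAt-injective : Injective _≡_ _≡_ variableAt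
    variableAt-injective = lookup-injective (deduplicate-! _≟ₙ_ (0 ∷ concatMap (map proj₂) φ))

    1≤k : 1 ≤ k
    1≤k = s≤s z≤n

  position : ∀ {p} → IsPoint p → Fin n
  position = index ∘ isPoint⇒∈

  pointAt-position : ∀ {p} (q : IsPoint p) → pointAt (position q) ≡ p
  pointAt-position q = sym (Any.lookup-index (isPoint⇒∈ q))

  module _ (α : ℕ → Bool) where

    chosenLiteral : Fin k → Literal′
    chosenLiteral i = α (variableAt i) , variableAt i

    chosen : Fin k → Fin n
    chosen i = position (isLiteral {proj₁ (chosenLiteral i)} {variableAt i} (∈-lookup i))

    pointAt-chosen : ∀ i → pointAt (chosen i) ≡ literalPoint (chosenLiteral i)
    pointAt-chosen i = pointAt-position (isLiteral (∈-lookup i))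

    chosen-injective : Injective _≡_ _≡_ chosen
    chosen-injective {i} {j} eq = variableAt-injective (cong proj₂ (List.∷-injectiveˡ (cong proj₂
      (trans (sym (pointAt-chosen i)) (trans (cong pointAt eq) (pointAt-chosen j))))))

  d : Fin n → Fin n → ℚ
  d i j = toℚ (δ (pointAt i) (pointAt j))

  d-isMetric : IsMetric _≡_ d
  d-isMetric = record
    { isSemiMetric = record
      { isQuasiSemiMetric = record
        { isPreMetric = record
          { isProtoMetric = record
            { isPartialOrder  = ℚ.≤-isPartialOrder
            ; ≈-isEquivalence = ≡.isEquivalence
            ; cong            = cong₂ d
            ; nonNegative     = λ {i} {j} → toℚ-mono {0} {δ (pointAt i) (pointAt j)} z≤n
            }
          ; ≈⇒0 = λ { {i} refl → cong toℚ (δ-refl (pointAt i)) }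
          }
        ; 0⇒≈ = λ eq → pointAt-injective (δ≡0⇒≡ (n≤0⇒n≡0 (toℚ-cancel (ℚ.≤-reflexive eq))))
        }
      ; sym = λ i j → cong toℚ (δ-sym (pointAt i) (pointAt j))
      }
    ; triangle = λ i j l → ℚ.≤-trans (toℚ-mono (δ-triangle (pointAt i) (pointAt j) (pointAt l)))
                                    (ℚ.≤-reflexive (toℚ-+ (δ (pointAt i) (pointAt j)) _))
    }

  kMedian : KMedianInstance
  kMedian = record
    -- Any assignment yields `k` distinct points, one literal for each variable.
    { n = n ; k = k ; 1≤k = 1≤k ; k≤n = Fin.injective⇒≤ (chosen-injective (λ _ → true))
    ; d = d ; isMetric = d-isMetric }

  open Solution

  pairwise : Fin n → Fin n → ℕ
  pairwise i j = δ (pointAt i) (pointAt j)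

  spread : Solution kMedian → Fin n → ℕ
  spread = distance kMedian pairwise (λ _ _ → refl) (pointAt-injective ∘ δ≡0⇒≡)

  total : Solution kMedian → ℕ
  total = totalDistance kMedian pairwise (λ _ _ → refl) (pointAt-injective ∘ δ≡0⇒≡)

  Satisfies : (ℕ → Bool) → Set
  Satisfies α = All (Any (λ (b , x) → α x ≡ b)) φ

  -- From a satisfying assignment to a cheap solution

  module Forward (α : ℕ → Bool) (sat : Satisfies α) where

    covered : ∀ {p} → IsPoint p → ∃ λ i → Covers (literalPoint (chosenLiteral α i)) p
    covered (isLiteral x∈)   = index x∈ , refl , inj₁ refl
    covered (isTautology {x} x∈) = index x∈ , refl , inj₂ (here (lemma (α (variableAt (index x∈))) (sym (Any.lookup-index x∈))))
      where
      lemma : ∀ b {y} → y ≡ x → (b , y) ∈ tautology x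
      lemma true  refl = here refl
      lemma false refl = there (here refl)
    covered (isClause {c} c∈φ) with find (All.lookup sat c∈φ)
    ... | (b , x) , l∈c , αx≡b = index x∈ , refl , inj₂ (here (lemma (sym (Any.lookup-index x∈))))
      where
      x∈ = variable∈ c∈φ l∈c
      lemma : ∀ {y} → y ≡ x → (α y , y) ∈ c
      lemma refl = subst (λ b → (b , x) ∈ c) (sym αx≡b) l∈c

    search : (x : Fin n) → Dec (∃ λ i → chosen α i ≡ x)
    search x = Fin.any? (λ i → chosen α i Fin.≟ x)

    -- Looking for the point among the centers first makes every center serve itself. This gives
    -- nonempty clusters and the `k` points of cost zero.
    nearest : (x : Fin n) → Dec (∃ λ i → chosen α i ≡ x) → Fin k
    nearest x (yes (i , _)) = i
    nearest x (no _)        = proj₁ (covered (∈⇒isPoint (∈-lookup {xs = points} x)))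

    nearest-chosen : ∀ i e → nearest (chosen α i) e ≡ i
    nearest-chosen i (yes (j , eq)) = chosen-injective α eq
    nearest-chosen i (no missed)    = contradiction (i , refl) missed

    nearest≤1 : ∀ x e → pairwise (chosen α (nearest x e)) x ≤ 1
    nearest≤1 x (yes (i , refl)) = ≤-trans (≤-reflexive (δ-refl (pointAt x))) z≤n
    nearest≤1 x (no _) with covered (∈⇒isPoint (∈-lookup {xs = points} x))
    ... | i , cov = subst (λ p → δ p (pointAt x) ≤ 1) (sym (pointAt-chosen α i)) (covers⇒δ≤1 cov)

    solution : Solution kMedian
    solution = record
      { center             = chosen α
      ; center-injective   = chosen-injective α
      ; cluster            = λ x → nearest x (search x)
      ; cluster-surjective = λ i → chosen α i , nearest-chosen i (search (chosen α i))
      }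

    solution-cheap : total solution + k ≤ n
    solution-cheap = distance≤1⇒cheap kMedian pairwise (λ _ _ → refl) (pointAt-injective ∘ δ≡0⇒≡) solution
      (λ i → trans (cong (λ j → pairwise (chosen α j) (chosen α i)) (nearest-chosen i (search (chosen α i))))
                   (δ-refl (pointAt (chosen α i))))
      (λ x → nearest≤1 x (search x))

  optimal⇒spread≤1 : ∀ {α} → Satisfies α → ∀ S → Optimal kMedian S → ∀ x → spread S x ≤ 1
  optimal⇒spread≤1 {α} sat S opt = cheap⇒distance≤1 kMedian pairwise (λ _ _ → refl) (pointAt-injective ∘ δ≡0⇒≡) S
    (≤-trans (+-monoˡ-≤ k (toℚ-cancel (subst₂ ℚ._≤_ (cost≡ S) (cost≡ solution) (opt solution)))) solution-cheap)
    where
    open Forward α sat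
    cost≡ = clusteringCost≡ kMedian pairwise (λ _ _ → refl) (pointAt-injective ∘ δ≡0⇒≡)

  -- From a cheap solution to a satisfying assignment

  near-clause : ∀ {p c} → IsPoint p → δ p (clausePoint c) ≤ 1 →
                p ≡ clausePoint c ⊎ ∃ λ l → p ≡ literalPoint l × l ∈ c
  near-clause P ≤1 with δ≤1⇒near ≤1
  ... | inj₁ p≡c                                   = inj₁ p≡c
  ... | inj₂ (inj₂ (() , _))
  near-clause (isLiteral _)   ≤1 | inj₂ (inj₁ (_ , inj₂ (here l∈c))) = inj₂ (_ , refl , l∈c)
  near-clause (isTautology _) ≤1 | inj₂ (inj₁ (() , _))
  near-clause (isClause _)    ≤1 | inj₂ (inj₁ (() , _))

  -- The closed neighbourhood of the tautology of `x`; `owner-unique` states that these sets are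
  -- disjoint.
  data Owner (x : ℕ) : Point → Set where
    literalOf   : ∀ b → Owner x (literalPoint (b , x))
    tautologyOf : Owner x (clausePoint (tautology x))

  owner-unique : ∀ {x y p} → Owner x p → Owner y p → x ≡ y
  owner-unique (literalOf b) (literalOf .b) = refl
  owner-unique tautologyOf   tautologyOf    = refl

  -- The neighbourhoods of the k tautologies are disjoint, so a center lies in
  -- each, and there is no center elsewhere.
  module Backward (S : Solution kMedian) (close : ∀ x → spread S x ≤ 1) where

    centerPoint : Fin k → Point
    centerPoint i = pointAt (center S i)

    centerPoint-near : ∀ {p} (P : IsPoint p) → δ (centerPoint (cluster S (position P))) p ≤ 1
    centerPoint-near P = subst (λ p → δ (centerPoint (cluster S (position P))) p ≤ 1) (pointAt-position P) (close (position P))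

    centerPoint-isPoint : ∀ i → IsPoint (centerPoint i)
    centerPoint-isPoint i = ∈⇒isPoint (∈-lookup (center S i))

    responsible : Fin k → Fin k
    responsible i = cluster S (position (isTautology (∈-lookup {xs = variables} i)))

    responsible-owned : ∀ i → Owner (variableAt i) (centerPoint (responsible i))
    responsible-owned i with near-clause (centerPoint-isPoint (responsible i)) (centerPoint-near (isTautology (∈-lookup i)))
    ... | inj₁ eq                                = subst (Owner _) (sym eq) tautologyOf
    ... | inj₂ (_ , eq , here refl)              = subst (Owner _) (sym eq) (literalOf true)
    ... | inj₂ (_ , eq , there (here refl))      = subst (Owner _) (sym eq) (literalOf false)

    responsible-injective : Injective _≡_ _≡_ responsible
    responsible-injective {i} {j} eq = variableAt-injective
      (owner-unique (responsible-owned i) (subst (Owner _ ∘ centerPoint) (sym eq) (responsible-owned j)))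

    -- Here it matters that there are exactly as many centers as variables: `responsible` is
    -- injective from `Fin k` to itself, hence it reaches every cluster.
    owned : ∀ j → ∃ λ i → responsible i ≡ j × Owner (variableAt i) (centerPoint j)
    owned j with injective⇒surjective responsible-injective j
    ... | i , refl = i , refl , responsible-owned i

    -- No neighbourhood holds two centers. In particular a literal and its negation are not both
    -- centers, which makes the assignment consistent.
    owner⇒center≡ : ∀ {x j j′} → Owner x (centerPoint j) → Owner x (centerPoint j′) → j ≡ j′
    owner⇒center≡ {j = j} {j′} o o′ with owned j | owned j′
    ... | i , refl , u | i′ , refl , u′ =
      cong responsible (variableAt-injective (trans (owner-unique u o) (owner-unique o′ u′)))

    module _ (α : ℕ → Bool) (α⇒chosen : ∀ {x} → α x ≡ true → ∃ λ j → centerPoint j ≡ literalPoint (true , x))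
             (chosen⇒α : ∀ {x} j → centerPoint j ≡ literalPoint (true , x) → α x ≡ true) where

      satisfies-center : ∀ b {x} j → centerPoint j ≡ literalPoint (b , x) → α x ≡ b
      satisfies-center true  j eq = chosen⇒α j eq
      satisfies-center false {x} j eq with α x in αx
      ... | false = refl
      -- Both literals of `x` would then be centers in one neighbourhood, hence the same center,
      -- although their signs differ.
      ... | true  with α⇒chosen αx
      ...   | j′ , eq′ with owner⇒center≡ {j = j} {j′} (subst (Owner x) (sym eq) (literalOf false)) (subst (Owner x) (sym eq′) (literalOf true))
      ...     | refl with trans (sym eq) eq′
      ...       | ()

      satisfies : Satisfies α
      satisfies = All.tabulate λ {c} c∈φ → clause-satisfied c∈φ (owned _) (near-clause (centerPoint-isPoint _) (centerPoint-near (isClause c∈φ)))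
        where
        tautology-satisfied : ∀ b x → α x ≡ b → Any (λ (b , x) → α x ≡ b) (tautology x)
        tautology-satisfied true  x eq = here eq
        tautology-satisfied false x eq = there (here eq)
        clause-satisfied : ∀ {c} (c∈φ : c ∈ φ) → let j = cluster S (position (isClause c∈φ)) in
          (∃ λ i → responsible i ≡ j × Owner (variableAt i) (centerPoint j)) →
          centerPoint j ≡ clausePoint c ⊎ (∃ λ l → centerPoint j ≡ literalPoint l × l ∈ c) →
          Any (λ (b , x) → α x ≡ b) c
        clause-satisfied c∈φ _ (inj₂ ((b , x) , eq , l∈c)) = lose l∈c (satisfies-center b _ eq)
        -- A clause that is itself a center lies in some neighbourhood, so it is a tautology and
        -- holds under every assignment.
        clause-satisfied c∈φ (i , _ , o) (inj₁ eq) with subst (Owner (variableAt i)) eq o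
        ... | tautologyOf = tautology-satisfied (α (variableAt i)) (variableAt i) refl

-- The reduction in polynomial time

coversₚ : ∀ {Γ p q} → PolyTime Γ point p → PolyTime Γ point q → PolyTime Γ bool (λ γ → does (covers? (p γ) (q γ)))
coversₚ {Γ} P Q = covers ∘ₚ (P & Q)
  where
  isTrue : ∀ {Γ b} → PolyTime Γ bool b → PolyTime Γ bool (λ γ → does (b γ Bool.≟ true))
  isTrue B = EqCode.≟ₚ eqBool ∘ₚ (B & constant true)
  covers : PolyTime (point ⊗ point) bool (λ (p , q) → does (covers? p q))
  covers = isTrue (first ∘ₚ first) ∧ₚ
    (isTrue (first ∘ₚ second) ∨ₚ
      anyₚ {Γ = point ⊗ point} (λ l (_ , (_ , c)) → l ∈ₗ? c)
        (memberₚ (eqPair eqBool eqNat) first (second ∘ₚ second ∘ₚ second)) (second ∘ₚ first))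

opaque
  unfolding δ Reduction.variables Reduction.points

  -- Three constants suffice, so no arithmetic on rationals has to be programmed.
  toℚ-δₚ : PolyTime (point ⊗ point) rat (λ (p , q) → toℚ (δ p q))
  toℚ-δₚ = ext (λ (p , q) → lemma (does (p ≟ₚₜ q)) (does (adjacent? p q)))
    (ifₚ (EqCode.≟ₚ eqPoint) (constant (toℚ 0))
      (ifₚ (coversₚ first second ∨ₚ coversₚ second first) (constant (toℚ 1)) (constant (toℚ 2))))
    where
    lemma : ∀ a b → (Bool.if a then toℚ 0 else (Bool.if b then toℚ 1 else toℚ 2)) ≡
                    toℚ (Bool.if a then 0 else (Bool.if b then 1 else 2))
    lemma true  _     = refl
    lemma false true  = refl
    lemma false false = refl

  variablesₚ : PolyTime (list clause) (list nat) Reduction.variables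
  variablesₚ = deduplicateₚ eqNat (consₚ (constant 0)
    (concatMapₚ {f = λ c _ → map proj₂ c} (mapₚ {f = λ l _ → proj₂ l} (second ∘ₚ first) first) identity))

  pointsₚ : PolyTime (list clause) (list point) Reduction.points
  pointsₚ = deduplicateₚ eqPoint (appendₚ
    (concatMapₚ {f = λ x _ → gadget x} gadgetₚ variablesₚ)
    (mapₚ {f = λ c _ → clausePoint c} (constant false & first) identity))
    where
    literalₚ : ∀ b → PolyTime (nat ⊗ list clause) literal (λ (x , _) → b , x)
    literalₚ b = constant b & first
    literalPointₚ : ∀ b → PolyTime (nat ⊗ list clause) point (λ (x , _) → literalPoint (b , x))
    literalPointₚ b = constant true & consₚ (literalₚ b) (constant [])
    gadgetₚ : PolyTime (nat ⊗ list clause) (list point) (λ (x , _) → gadget x)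
    gadgetₚ = consₚ (literalPointₚ true) (consₚ (literalPointₚ false)
      (consₚ (constant false & consₚ (literalₚ true) (consₚ (literalₚ false) (constant []))) (constant [])))

instanceCode : Code
instanceCode = record { enc = encodeKMedianInstance }

-- The program produces the distance matrix by mapping over the list of points, whereas the encoding
-- of an instance tabulates it over indices.
tabulate²-lookup : ∀ {A B : Set} (f : A → A → B) xs →
  map (λ x → map (f x) xs) xs ≡ tabulate (λ i → tabulate (λ j → f (lookup xs i) (lookup xs j)))
tabulate²-lookup f xs = trans (once (λ x → map (f x) xs) xs) (List.tabulate-cong λ i → once (f (lookup xs i)) xs)
  where
  once : ∀ {A B : Set} (f : A → B) xs → map f xs ≡ tabulate (f ∘ lookup xs)
  once f xs = trans (cong (map f) (sym (List.tabulate-lookup xs))) (List.map-tabulate (lookup xs) f)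

kMedianₚ : PolyTime (list clause) instanceCode Reduction.kMedian
kMedianₚ = recode {A = list clause} {B = nat ⊗ list (list rat)}
  {f = λ φ → Reduction.k φ , map (λ p → map (λ q → toℚ (δ p q)) (Reduction.points φ)) (Reduction.points φ)}
  id (λ _ → refl)
  (λ φ → cong (λ m → encodeℕ (Reduction.k φ) ∙ encodeList (encodeList encodeℚ) m)
           (tabulate²-lookup (λ p q → toℚ (δ p q)) (Reduction.points φ)))
  (lengthₚ variablesₚ &
   mapₚ {f = λ p φ → map (λ q → toℚ (δ p q)) (Reduction.points φ)}
     (mapₚ {f = λ q (p , _) → toℚ (δ p q)} (toℚ-δₚ ∘ₚ (first ∘ₚ second & first)) (pointsₚ ∘ₚ second)) pointsₚ)

-- Reading the assignment off a solution

-- A solution names its centers by binary indices. Instead of looking an index up, the fold scans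
-- all points with a running counter and keeps those whose position is listed.
select : ℕ × List Point → Point → List ℕ → ℕ × List Point
select (i , ps) p is = suc i , (Bool.if does (i ∈ₙ? is) then p ∷ ps else ps)

selected : List ℕ → List Point → List Point
selected is ps = proj₂ (foldl (λ s p → select s p is) (0 , []) ps)

selectₚ : PolyTime (((nat ⊗ list point) ⊗ point) ⊗ list nat) (nat ⊗ list point) (λ ((s , p) , is) → select s p is)
selectₚ = sucₚ ∘ₚ first ∘ₚ first ∘ₚ first &
  ifₚ (memberₚ eqNat (first ∘ₚ first ∘ₚ first) second)
    (consₚ (second ∘ₚ first) (second ∘ₚ first ∘ₚ first)) (second ∘ₚ first ∘ₚ first)

select-additive : Additive (nat ⊗ list point) point (list nat) select
select-additive = record
  { weight      = λ (i , ps) → 1 + (binaryWeight i + size (enc (list point) ps))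
  ; conversion  = K 2 ⊕ K 4 ⊛ X
  -- Four for the counter, one for a new list cell, and the rest for the point in it.
  ; increment   = K 5 ⊕ X
  ; size≤weight = λ (i , ps) → s≤s (+-monoˡ-≤ (size (enc (list point) ps)) (size≤binaryWeight i))
  ; weight≤     = λ (i , ps) → s≤s (begin
      binaryWeight i + size (enc (list point) ps)
        ≤⟨ +-mono-≤ (binaryWeight≤ i) (m≤n*m (size (enc (list point) ps)) 4) ⟩
      1 + 4 * size (encodeℕ i) + 4 * size (enc (list point) ps)
        ≡⟨ cong suc (*-distribˡ-+ 4 (size (encodeℕ i)) _) ⟨
      1 + 4 * (size (encodeℕ i) + size (enc (list point) ps))
        ≤⟨ s≤s (*-monoʳ-≤ 4 (n≤1+n _)) ⟩
      1 + 4 * suc (size (encodeℕ i) + size (enc (list point) ps)) ∎)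
  ; weight≤+    = λ (i , ps) p is → s≤s (begin
      binaryWeight (suc i) + size (enc (list point) (Bool.if does (i ∈ₙ? is) then p ∷ ps else ps))
        ≤⟨ +-mono-≤ (binaryWeight-suc i) (size-if (does (i ∈ₙ? is)) ps p) ⟩
      binaryWeight i + 4 + (size (enc (list point) ps) + (1 + size (enc point p)))
        ≡⟨ lemma (binaryWeight i) (size (enc (list point) ps)) (size (enc point p)) ⟩
      binaryWeight i + size (enc (list point) ps) + (5 + size (enc point p))
        ≤⟨ +-monoʳ-≤ (binaryWeight i + size (enc (list point) ps)) (+-monoʳ-≤ 5 (m≤m+n _ _)) ⟩
      binaryWeight i + size (enc (list point) ps) + (5 + (size (enc point p) + size (enc (list nat) is))) ∎)
  }
  where
  open ≤-Reasoning
  lemma : ∀ a b c → a + 4 + (b + (1 + c)) ≡ a + b + (5 + c)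
  lemma = solve-∀
  size-if : ∀ b ps p → size (enc (list point) (Bool.if b then p ∷ ps else ps)) ≤
                       size (enc (list point) ps) + (1 + size (enc point p))
  size-if true  ps p = ≤-reflexive (+-comm (suc (size (enc point p))) _)
  size-if false ps p = m≤m+n _ _

selectedₚ : ∀ {Γ is ps} → PolyTime Γ (list nat) is → PolyTime Γ (list point) ps →
            PolyTime Γ (list point) (λ γ → selected (is γ) (ps γ))
selectedₚ IS PS = second ∘ₚ
  foldlₚ {Γ = list nat ⊗ list point} {f = λ s p (is , _) → select s p is} (selectₚ ∘ₚ (first & first ∘ₚ second)) weaker
    second (constant (0 , [])) ∘ₚ (IS & PS)
  where
  weaker : Additive (nat ⊗ list point) point (list nat ⊗ list point) (λ s p (is , _) → select s p is)
  weaker = record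
    { weight = weight select-additive ; conversion = conversion select-additive ; increment = increment select-additive
    ; size≤weight = size≤weight select-additive ; weight≤ = weight≤ select-additive
    ; weight≤+ = λ s p (is , ps) → ≤-trans (weight≤+ select-additive s p is)
        (+-monoʳ-≤ (weight select-additive s) (+-monoʳ-≤ 5 (+-monoʳ-≤ (size (enc point p)) (m≤n⇒m≤1+n (m≤m+n _ _)))))
    }

module _ {p : Point} (is : List ℕ) where

  ∈-select⁻ : ∀ i qs q → p ∈ proj₂ (select (i , qs) q is) → p ∈ qs ⊎ (q ≡ p × i ∈ is)
  ∈-select⁻ i qs q = lemma (i ∈ₙ? is)
    where
    lemma : (e : Dec (i ∈ is)) → p ∈ (Bool.if does e then q ∷ qs else qs) → p ∈ qs ⊎ (q ≡ p × i ∈ is)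
    lemma (yes i∈) (here p≡q) = inj₂ (sym p≡q , i∈)
    lemma (yes i∈) (there p∈) = inj₁ p∈
    lemma (no _)   p∈         = inj₁ p∈

  ∈-select⁺ : ∀ i qs q → p ∈ qs ⊎ (q ≡ p × i ∈ is) → p ∈ proj₂ (select (i , qs) q is)
  ∈-select⁺ i qs q = lemma (i ∈ₙ? is)
    where
    lemma : (e : Dec (i ∈ is)) → p ∈ qs ⊎ (q ≡ p × i ∈ is) → p ∈ (Bool.if does e then q ∷ qs else qs)
    lemma (yes i∈) (inj₁ p∈)         = there p∈
    lemma (yes i∈) (inj₂ (refl , _)) = here refl
    lemma (no _)   (inj₁ p∈)         = p∈
    lemma (no i∉)  (inj₂ (_ , i∈))   = contradiction i∈ i∉

  ∈-foldl-select⁻ : ∀ i qs ps → p ∈ proj₂ (foldl (λ s p → select s p is) (i , qs) ps) →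
                    p ∈ qs ⊎ ∃ λ j → lookup ps j ≡ p × i + toℕ j ∈ is
  ∈-foldl-select⁻ i qs []       p∈ = inj₁ p∈
  ∈-foldl-select⁻ i qs (q ∷ ps) p∈ with ∈-foldl-select⁻ (suc i) (proj₂ (select (i , qs) q is)) ps p∈
  ... | inj₂ (j , eq , j∈) = inj₂ (suc j , eq , subst (_∈ is) (sym (+-suc i (toℕ j))) j∈)
  ... | inj₁ p∈′ with ∈-select⁻ i qs q p∈′
  ...   | inj₁ p∈qs       = inj₁ p∈qs
  ...   | inj₂ (q≡p , i∈) = inj₂ (zero , q≡p , subst (_∈ is) (sym (+-identityʳ i)) i∈)

  ∈-foldl-select⁺ : ∀ i qs ps → p ∈ qs ⊎ (∃ λ j → lookup ps j ≡ p × i + toℕ j ∈ is) →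
                    p ∈ proj₂ (foldl (λ s p → select s p is) (i , qs) ps)
  ∈-foldl-select⁺ i qs []       (inj₁ p∈) = p∈
  ∈-foldl-select⁺ i qs (q ∷ ps) (inj₁ p∈) =
    ∈-foldl-select⁺ (suc i) _ ps (inj₁ (∈-select⁺ i qs q (inj₁ p∈)))
  ∈-foldl-select⁺ i qs (q ∷ ps) (inj₂ (zero , eq , i∈)) =
    ∈-foldl-select⁺ (suc i) _ ps (inj₁ (∈-select⁺ i qs q (inj₂ (eq , subst (_∈ is) (+-identityʳ i) i∈))))
  ∈-foldl-select⁺ i qs (q ∷ ps) (inj₂ (suc j , eq , j∈)) =
    ∈-foldl-select⁺ (suc i) _ ps (inj₂ (j , eq , subst (_∈ is) (+-suc i (toℕ j)) j∈))

-- A variable is false unless its positive literal is a center. The default also covers variables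
-- represented by their tautology; in a cheap solution no clause is served by a literal of such a
-- variable.
assignment : List ℕ → List Clause → ℕ → Bool
assignment is φ x = does (literalPoint (true , x) ∈ₚₜ? selected is (Reduction.points φ))

satisfies? : ∀ is φ → Dec (Reduction.Satisfies φ (assignment is φ))
satisfies? is φ = All.all? (Any.any? (λ (b , x) → assignment is φ x Bool.≟ b)) φ

satisfiesₚ : PolyTime (list nat ⊗ list clause) bool (λ (is , φ) → does (satisfies? is φ))
satisfiesₚ = ext (λ _ → refl) (checkₚ ∘ₚ (second & selectedₚ first (pointsₚ ∘ₚ second)))
  where
  Holds : Literal′ → List Point → Set
  Holds (b , x) ps = does (literalPoint (true , x) ∈ₚₜ? ps) ≡ b
  holds? : ∀ l ps → Dec (Holds l ps)
  holds? (b , x) ps = does (literalPoint (true , x) ∈ₚₜ? ps) Bool.≟ b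
  holdsₚ : PolyTime (literal ⊗ list point) bool (λ (l , ps) → does (holds? l ps))
  holdsₚ = EqCode.≟ₚ eqBool ∘ₚ
    (memberₚ eqPoint (constant true & consₚ (constant true & second ∘ₚ first) (constant [])) second & first ∘ₚ first)
  checkₚ : PolyTime (list clause ⊗ list point) bool
             (λ (φ , ps) → does (All.all? (λ c → Any.any? (λ l → holds? l ps) c) φ))
  checkₚ = allₚ {Γ = list clause ⊗ list point} (λ c (_ , ps) → Any.any? (λ l → holds? l ps) c)
    (anyₚ {Γ = clause ⊗ (list clause ⊗ list point)} (λ l (_ , (_ , ps)) → holds? l ps)
      (holdsₚ ∘ₚ (first & second ∘ₚ second ∘ₚ second)) first)
    first

module _ (φ : List Clause) (S : Solution (Reduction.kMedian φ)) where
  open Reduction φ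
  open Solution S

  centers : List ℕ
  centers = map toℕ (tabulate center)

  chosen⇒assigned : ∀ {x} j → pointAt (center j) ≡ literalPoint (true , x) → assignment centers φ x ≡ true
  chosen⇒assigned {x} j eq = lemma (literalPoint (true , x) ∈ₚₜ? selected centers points)
    where
    lemma : (e : Dec (literalPoint (true , x) ∈ selected centers points)) → does e ≡ true
    lemma (yes _) = refl
    lemma (no p∉) = contradiction
      (∈-foldl-select⁺ centers 0 [] points (inj₂ (center j , eq , ∈-map⁺ toℕ (∈-tabulate⁺ j)))) p∉

  assigned⇒chosen : ∀ {x} → assignment centers φ x ≡ true → ∃ λ j → pointAt (center j) ≡ literalPoint (true , x)
  assigned⇒chosen {x} = lemma (literalPoint (true , x) ∈ₚₜ? selected centers points)
    where
    lemma : (e : Dec (literalPoint (true , x) ∈ selected centers points)) → does e ≡ true →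
            ∃ λ j → pointAt (center j) ≡ literalPoint (true , x)
    lemma (yes p∈) _ with ∈-foldl-select⁻ centers 0 [] points p∈
    ... | inj₂ (i , eq , i∈) with ∈-map⁻ toℕ i∈
    ...   | i′ , i′∈ , i≡i′ with ∈-tabulate⁻ i′∈
    ...     | j , refl = j , trans (cong pointAt (sym (Fin.toℕ-injective i≡i′))) eq

  satisfiable⇒accepted : Optimal kMedian S → ∀ {α} → Satisfies α → Satisfies (assignment centers φ)
  satisfiable⇒accepted opt sat = Backward.satisfies S (optimal⇒spread≤1 sat S opt)
    (assignment centers φ) assigned⇒chosen chosen⇒assigned

-- Passing between formulas with bounded variables and clauses over ℕ

translate : ∀ {N} → Literal N → Literal′
translate (pos x) = true , toℕ x
translate (neg x) = false , toℕ x

clauses′ : ∀ {q} → CNF q → List Clause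
clauses′ φ = map (map translate) (CNF.clauses φ)

encodeList-map : ∀ {A B : Set} {e : A → Tree} {e′ : B → Tree} {g : A → B} → (∀ a → e′ (g a) ≡ e a) →
                 ∀ xs → encodeList e′ (map g xs) ≡ encodeList e xs
encodeList-map eq []       = refl
encodeList-map eq (x ∷ xs) = cong₂ _∙_ (eq x) (encodeList-map eq xs)

enc-clauses′ : ∀ {q} (φ : CNF q) → enc (list clause) (clauses′ φ) ≡ encodeList (encodeList encodeLiteral) (CNF.clauses φ)
enc-clauses′ φ = encodeList-map (encodeList-map λ { (pos x) → refl ; (neg x) → refl }) (CNF.clauses φ)

module _ {q} (φ : CNF q) where

  extend : (Fin (#vars φ) → Bool) → ℕ → Bool
  extend α x with x <? #vars φ
  ... | yes x< = α (Fin.fromℕ< x<)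
  -- Among the variables of the reduction only the added variable 0 can be out of range, when the
  -- formula has no variables at all; either value will do.
  ... | no _   = false

  extend-toℕ : ∀ α i → extend α (toℕ i) ≡ α i
  extend-toℕ α i with toℕ i <? #vars φ
  ... | yes i< = cong α (Fin.fromℕ<-toℕ i i<)
  ... | no i≮  = contradiction (Fin.toℕ<n i) i≮

  satisfiable⇒satisfies : ((α , _) : Satisfiable φ) → Reduction.Satisfies (clauses′ φ) (extend α)
  satisfiable⇒satisfies (α , sat) = All.map⁺ (All.map (λ any → Any.map⁺ (Any.map (λ {l} → literal-holds l) any)) sat)
    where
    literal-holds : ∀ l → value α l ≡ true → extend α (proj₂ (translate l)) ≡ proj₁ (translate l)
    literal-holds (pos x) eq = trans (extend-toℕ α x) eq
    literal-holds (neg x) eq = trans (extend-toℕ α x) (Bool.not-injective eq)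

  satisfies⇒satisfiable : ∀ {α} → Reduction.Satisfies (clauses′ φ) α → Satisfiable φ
  satisfies⇒satisfiable {α} sat = α ∘ toℕ , All.map (λ any → Any.map (λ {l} → literal-holds l) (Any.map⁻ any)) (All.map⁻ sat)
    where
    literal-holds : ∀ l → α (proj₂ (translate l)) ≡ proj₁ (translate l) → value (α ∘ toℕ) l ≡ true
    literal-holds (pos x) eq = eq
    literal-holds (neg x) eq = cong not eq

  -- Soundness holds for whatever centers are reported, since the test checks an explicit
  -- assignment; optimality enters only in the refutation.
  decide : ∀ S → Optimal (Reduction.kMedian (clauses′ φ)) S → Dec (Satisfiable φ)
  decide S opt = map′ satisfies⇒satisfiable (λ sat → satisfiable⇒accepted (clauses′ φ) S opt (satisfiable⇒satisfies sat))
    (satisfies? (centers (clauses′ φ) S) (clauses′ φ))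

-- Sizes of instances and solutions

size-encodeℕ≤ : ∀ n → size (encodeℕ n) ≤ 1 + 4 * n
size-encodeℕ≤ n = ≤-trans (size≤binaryWeight n) (lemma n)
  where
  lemma : ∀ n → binaryWeight n ≤ 1 + 4 * n
  lemma zero    = ≤-refl
  lemma (suc n) = ≤-trans (binaryWeight-suc n) (≤-trans (+-monoˡ-≤ 4 (lemma n))
    (≤-reflexive (cong suc (trans (+-comm (4 * n) 4) (sym (*-suc 4 n))))))

size-encodeList≤ : ∀ {A : Set} {e : A → Tree} {m} → (∀ x → size (e x) ≤ m) →
                   ∀ xs → size (encodeList e xs) ≤ 1 + length xs * (1 + m)
size-encodeList≤ e≤ []       = ≤-refl
size-encodeList≤ {m = m} e≤ (x ∷ xs) = s≤s (≤-trans (+-mono-≤ (e≤ x) (size-encodeList≤ e≤ xs)) (≤-reflexive (+-suc m _)))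

#points≤size : ∀ I → #points I ≤ size (encodeKMedianInstance I)
#points≤size I = ≤-trans (≤-reflexive (sym (List.length-tabulate rows)))
  (≤-trans (length≤size {list rat} (tabulate rows)) (m≤n⇒m≤1+n (m≤n+m _ (size (encodeℕ (KMedianInstance.k I))))))
  where
  rows : Fin (#points I) → List ℚ
  rows x = tabulate (KMedianInstance.d I x)

-- Two lists of at most X indices, each index taking at most 1 + 4 X nodes and one more for its
-- cell.
solutionSize : Polynomial
solutionSize = K 1 ⊕ ((K 1 ⊕ X ⊛ (K 2 ⊕ K 4 ⊛ X)) ⊕ (K 1 ⊕ X ⊛ (K 2 ⊕ K 4 ⊛ X)))

-- A correct output has a prescribed shape, so it is small however long the solver ran. This keeps
-- the final test polynomial in the size of the formula.
size-encodeSolution≤ : ∀ I S → size (encodeSolution I S) ≤ ⟦ solutionSize ⟧ (size (encodeKMedianInstance I))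
size-encodeSolution≤ I S = ≤-trans
  (s≤s (+-mono-≤ (indices k≤n ≤-refl center) (indices ≤-refl k≤n cluster)))
  (⟦⟧-mono solutionSize (#points≤size I))
  where
  open KMedianInstance I
  open Solution S
  indices : ∀ {l m} → l ≤ n → m ≤ n → (g : Fin l → Fin m) →
            size (encodeList encodeFin (tabulate g)) ≤ 1 + n * (2 + 4 * n)
  indices {l} {m} l≤n m≤n g = ≤-trans
    (size-encodeList≤ (λ i → ≤-trans (size-encodeℕ≤ (toℕ i)) (s≤s (*-monoʳ-≤ 4 (≤-trans (Fin.toℕ≤n i) m≤n)))) (tabulate g))
    (s≤s (*-monoˡ-≤ (2 + 4 * n) (≤-trans (≤-reflexive (List.length-tabulate g)) l≤n)))

length-concatMap≤ : ∀ {A B : Set} {f : A → List B} {m xs} → All (λ x → length (f x) ≤ m) xs →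
                    length (concatMap f xs) ≤ length xs * m
length-concatMap≤ []                = z≤n
length-concatMap≤ {f = f} {xs = x ∷ xs} (≤m ∷ ≤ms) =
  ≤-trans (≤-reflexive (List.length-++ (f x))) (+-mono-≤ ≤m (length-concatMap≤ ≤ms))

opaque
  unfolding Reduction.variables Reduction.points

  length-points≤ : ∀ {q φ} → All (λ c → length c ≤ q) φ → Reduction.n φ ≤ suc (length φ * q) * 3 + length φ
  length-points≤ {q} {φ} width = begin
    length points
      ≤⟨ List.length-deduplicate _≟ₚₜ_ (concatMap gadget variables ++ map clausePoint φ) ⟩
    length (concatMap gadget variables ++ map clausePoint φ)
      ≡⟨ List.length-++ (concatMap gadget variables) ⟩
    length (concatMap gadget variables) + length (map clausePoint φ)
      ≤⟨ +-mono-≤ (length-concatMap≤ {f = gadget} {m = 3} (All.universal (λ _ → ≤-refl) variables))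
                  (≤-reflexive (List.length-map clausePoint φ)) ⟩
    length variables * 3 + length φ
      ≤⟨ +-monoˡ-≤ (length φ) (*-monoˡ-≤ 3 variables≤) ⟩
    suc (length φ * q) * 3 + length φ ∎
    where
    open ≤-Reasoning
    open Reduction φ
    variables≤ : length variables ≤ suc (length φ * q)
    variables≤ = ≤-trans (List.length-deduplicate _≟ₙ_ (0 ∷ concatMap (map proj₂) φ))
      (s≤s (length-concatMap≤ {f = map proj₂} (All.map (λ {c} → ≤-trans (≤-reflexive (List.length-map proj₂ c))) width)))

-- With M clauses there are at most 3 M occurring variables and the variable 0, three points for
-- each, and M further points for the clauses.
#points≤ : ∀ (φ : CNF 3) → Reduction.n (clauses′ φ) ≤ 3 + 10 * #clauses φ
#points≤ φ = ≤-trans (length-points≤ (All.map⁺ (All.map (λ {c} → ≤-trans (≤-reflexive (List.length-map translate c))) (CNF.width φ))))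
  (≤-reflexive (trans (cong (λ m → suc (m * 3) * 3 + m) (List.length-map (map translate) (CNF.clauses φ))) (lemma (#clauses φ))))
  where
  lemma : ∀ m → suc (m * 3) * 3 + m ≡ 3 + 10 * m
  lemma = solve-∀

-- Little-o under a linear change of the parameter

-- The exponent `f` need not be monotone, so a bound on the number of points bounds `f` only through
-- its running maximum.
maxUpTo : (ℕ → ℕ) → ℕ → ℕ
maxUpTo f zero    = f zero
maxUpTo f (suc n) = f (suc n) ⊔ maxUpTo f n

≤maxUpTo : ∀ f {i} n → i ≤ n → f i ≤ maxUpTo f n
≤maxUpTo f zero    z≤n = ≤-refl
≤maxUpTo f (suc n) i≤  with m≤n⇒m<n∨m≡n i≤
... | inj₁ (s≤s i≤n) = ≤-trans (≤maxUpTo f n i≤n) (m≤n⊔m (f (suc n)) _)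
... | inj₂ refl      = m≤m⊔n (f (suc n)) _

*-maxUpTo≤ : ∀ c f {m} n → (∀ i → i ≤ n → c * f i ≤ m) → c * maxUpTo f n ≤ m
*-maxUpTo≤ c f zero    ≤m = ≤m zero z≤n
*-maxUpTo≤ c f (suc n) ≤m = ≤-trans (≤-reflexive (*-distribˡ-⊔ c (f (suc n)) _))
  (⊔-lub (≤m (suc n) ≤-refl) (*-maxUpTo≤ c f n (λ i i≤n → ≤m i (m≤n⇒m≤1+n i≤n))))

LittleO-maxUpTo : ∀ {f} → LittleO f → LittleO (λ m → maxUpTo f (3 + 10 * m))
LittleO-maxUpTo {f} f-o c with f-o (13 * c)
-- Arguments beyond `n₀` are handled by the factor 13, because 3 + 10 m ≤ 13 m for m ≥ 1. The
-- finitely many others are bounded by a constant, which the threshold exceeds; its `suc` also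
-- ensures m ≥ 1.
... | n₀ , f≤ = suc (c * maxUpTo f n₀) , λ m m≥ → *-maxUpTo≤ c f (3 + 10 * m) λ i i≤ → bound m m≥ i i≤ (≤-total n₀ i)
  where
  open ≤-Reasoning
  bound : ∀ m → suc (c * maxUpTo f n₀) ≤ m → ∀ i → i ≤ 3 + 10 * m → n₀ ≤ i ⊎ i ≤ n₀ → c * f i ≤ m
  bound m m≥ i i≤ (inj₁ n₀≤i) = *-cancelˡ-≤ 13 (begin
    13 * (c * f i)    ≡⟨ *-assoc 13 c (f i) ⟨
    13 * c * f i      ≤⟨ f≤ i n₀≤i ⟩
    i                 ≤⟨ i≤ ⟩
    3 + 10 * m        ≤⟨ +-monoˡ-≤ (10 * m) (*-monoʳ-≤ 3 (≤-trans (s≤s z≤n) m≥)) ⟩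
    3 * m + 10 * m    ≡⟨ *-distribʳ-+ m 3 10 ⟨
    13 * m            ∎)
  bound m m≥ i i≤ (inj₂ i≤n₀) = begin
    c * f i            ≤⟨ *-monoʳ-≤ c (≤maxUpTo f n₀ i≤n₀) ⟩
    c * maxUpTo f n₀   ≤⟨ n≤1+n _ ⟩
    suc (c * maxUpTo f n₀) ≤⟨ m≥ ⟩
    m                  ∎

-- Solving 3-SAT through k-median

formula solutionCode : Code
formula      = record { enc = Problem.encode (SAT 3) }
solutionCode = list nat ⊗ list nat

enc-formula : ∀ φ → enc (nat ⊗ list clause) (#vars φ , clauses′ φ) ≡ enc formula φ
enc-formula φ = cong (encodeℕ (#vars φ) ∙_) (enc-clauses′ φ)

clausesₚ : PolyTime formula (list clause) clauses′
clausesₚ = recode {A = nat ⊗ list clause} {B = list clause} (λ φ → #vars φ , clauses′ φ) enc-formula (λ _ → refl) second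

opaque

  reduceₚ : PolyTime formula instanceCode (Reduction.kMedian ∘ clauses′)
  reduceₚ = kMedianₚ ∘ₚ clausesₚ

  acceptsₚ : PolyTime (solutionCode ⊗ formula) bool (λ ((is , _) , φ) → does (satisfies? is (clauses′ φ)))
  acceptsₚ = satisfiesₚ ∘ₚ (first ∘ₚ first & clausesₚ ∘ₚ second)

reduced : CNF 3 → KMedianInstance
reduced φ = Reduction.kMedian (clauses′ φ)

enc-solution : ∀ (φ : CNF 3) S →
               enc solutionCode (centers (clauses′ φ) S , map toℕ (tabulate (Solution.cluster S))) ≡
               encodeSolution (reduced φ) S
enc-solution φ S = cong₂ _∙_ (encodeList-map (λ _ → refl) (tabulate (Solution.center S)))
                             (encodeList-map (λ _ → refl) (tabulate (Solution.cluster S)))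

answer : ∀ (φ : CNF 3) → Solution (reduced φ) → Tree
answer φ S = encodeBool (does (satisfies? (centers (clauses′ φ) S) (clauses′ φ)))

accepts-runs : ∀ {v} φ S (σ : Store v) →
  ⟨ cmd acceptsₚ , (encodeSolution (reduced φ) S ∙ enc formula φ) ∷ nil ∷ σ ⟩⇒ answer φ S ∷ nil ∷ σ
    within ⟦ time acceptsₚ ⟧ (size (encodeSolution (reduced φ) S ∙ enc formula φ))
accepts-runs φ S σ =
  subst (λ t → ⟨ cmd acceptsₚ , (t ∙ enc formula φ) ∷ nil ∷ σ ⟩⇒ answer φ S ∷ nil ∷ σ
                 within ⟦ time acceptsₚ ⟧ (size (t ∙ enc formula φ)))
    (enc-solution φ S) (runs acceptsₚ ((centers (clauses′ φ) S , _) , φ) nil σ)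

module _ {v} (body : Cmd (suc v)) (f : ℕ → ℕ) (a b : ℕ) where

  -- One summand for each of the six commands of `whole`. The solver's exponential factor is left
  -- out here and later multiplies the entire sum, which is harmless as it is at least 1.
  bound : Polynomial
  bound = K 4 ⊕ (time reduceₚ ⊕ (K a ⊛ power b ⊚ growth reduceₚ ⊕
            (K 5 ⊕ (K 3 ⊕ time acceptsₚ ⊚ (K 1 ⊕ solutionSize ⊚ growth reduceₚ ⊕ X)))))

  g : ℕ → ℕ
  g m = maxUpTo f (3 + 10 * m)

  -- Variable one holds the formula and is hidden from the solver. Since `cmd reduceₚ` leaves the
  -- variables after it untouched, the solver finds its own variables nil, as `Runs` demands;
  -- `cmd acceptsₚ` tolerates whatever the solver leaves in them.
  whole : Cmd (2 + v)
  whole = stk := cons (var val) (var stk)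
        ⨾ cmd reduceₚ
        ⨾ weakenCmd (suc zero) body
        ⨾ val := cons (var val) (hd (var stk))
        ⨾ stk := tl (var stk)
        ⨾ cmd acceptsₚ

  module _ (a′ b′ : ℕ) (bound≤ : ∀ s → .{{NonZero s}} → ⟦ bound ⟧ s ≤ a′ * s ^ b′) (φ : CNF 3) where
    W = 2 ^ g (#clauses φ)
    s = size (enc formula φ)
    G = ⟦ growth reduceₚ ⟧ s

    infixr 6 _⊞_

    _⊞_ : ∀ {x x′ y y′} → x ≤ W * y → x′ ≤ W * y′ → x + x′ ≤ W * (y + y′)
    p ⊞ q = ≤-trans (+-mono-≤ p q) (≤-reflexive (sym (*-distribˡ-+ W _ _)))

    scale : ∀ {x y} → x ≤ y → x ≤ W * y
    scale x≤y = ≤-trans x≤y (m≤n*m _ W {{m^n≢0 2 (g (#clauses φ))}})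

    solver-time : ∀ {t} → t ≤ 2 ^ f (#points (reduced φ)) * (a * size (encodeKMedianInstance (reduced φ)) ^ b) →
                  t ≤ W * (a * ⟦ power b ⟧ G)
    solver-time t≤ = ≤-trans t≤ (*-mono-≤ (^-monoʳ-≤ 2 (≤maxUpTo f _ (#points≤ φ)))
      (*-monoʳ-≤ a (≤-trans (^-monoˡ-≤ b (size≤ reduceₚ φ)) (≤-reflexive (sym (⟦power⟧ b G))))))

    satSolves : (∃ λ output → ∃ λ t → Runs (program body) (encodeKMedianInstance (reduced φ)) output t ×
                  Problem.Correct KMedian (reduced φ) output ×
                  t ≤ 2 ^ f (#points (reduced φ)) * (a * size (encodeKMedianInstance (reduced φ)) ^ b)) →
                ∃ λ output → ∃ λ t → Runs (program whole) (enc formula φ) output t ×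
                  Problem.Correct (SAT 3) φ output ×
                  t ≤ W * (a′ * s ^ b′)
    satSolves (_ , t , (σ , solver-runs) , (S , refl , opt) , t≤) =
      answer φ S , steps all , (nil ∷ σ , exec all) , (decide φ S opt , refl) ,
      ≤-trans (steps≤ all) (≤-trans
        (scale (≤-refl {4}) ⊞ scale (≤-refl {⟦ time reduceₚ ⟧ s}) ⊞ solver-time t≤ ⊞
          scale (≤-refl {5}) ⊞ scale (≤-refl {3}) ⊞ scale accepts-time)
        (*-monoʳ-≤ W (bound≤ s {{size>0 (enc formula φ)}})))
      where
      all = assign′ ▷ runs reduceₚ φ (enc formula φ ∙ nil) (Vec.replicate v nil)
          ▷ run (exec-weaken (suc zero) (enc formula φ ∙ nil) solver-runs) ≤-refl
          ▷ assign′ ▷ assign′ ▷ accepts-runs φ S σ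
      accepts-time : ⟦ time acceptsₚ ⟧ (size (encodeSolution (reduced φ) S ∙ enc formula φ)) ≤
                     ⟦ time acceptsₚ ⟧ (1 + ⟦ solutionSize ⟧ G + s)
      accepts-time = ⟦⟧-mono (time acceptsₚ) (s≤s (+-monoˡ-≤ s
        (≤-trans (size-encodeSolution≤ (reduced φ) S) (⟦⟧-mono solutionSize (size≤ reduceₚ φ)))))

kMedian⇒3SAT : SolvableInTime2^o KMedian #points → SolvableInTime2^o (SAT 3) #clauses
kMedian⇒3SAT (program body , f , f-o , a , b , solves) =
  program (whole body f a b) , g body f a b , LittleO-maxUpTo f-o , a′ , b′ ,
  λ φ → satSolves body f a b a′ b′ bound≤ φ (solves (reduced φ))
  where
  monomial = ⟦⟧-monomial (bound body f a b)
  a′ = proj₁ monomial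
  b′ = proj₁ (proj₂ monomial)
  bound≤ = proj₂ (proj₂ monomial)

theorem6 : ETH → ¬ SolvableInTime2^o KMedian #points
theorem6 eth solver = proj₂ (eth 3 ≤-refl) (kMedian⇒3SAT solver)
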